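{- Let $k,n\in\mathbb{N}$ and let $G_1,\dots,G_n$ be graphs, each with at most $k$ vertices. (1) If the graphs $G_1,\dots,G_n$ are connected, then for any connected graph $H_4$ with exactly $4$ vertices and any connected graph $H_k$ with exactly $k$ vertices, the graph $H_4\times C_{6n-2}\times H_k\times G_1\times\cdots\times G_n$ is $\frac{1}{16}|V(G_1)|\cdots|V(G_n)|$-minor-universal. (2) For every integer $k\ge 2$ there is a constant $C=C(k)$ such that for every $n\in\mathbb{N}$ and all graphs $G_1,\dots,G_n$ each with at most $k$ vertices, the graph $G_1\times\cdots\times G_n$ is not $\frac{C k^n}{\sqrt{n}}$-minor-universal.
   Context: All graphs are finite and simple. $G\times H$ denotes the Cartesian (box) product: vertex set $V(G)\times V(H)$, with $(g,h)\sim(g',h')$ iff either $g=g'$ and $h\sim h'$, or $g\sim g'$ and $h=h'$. $C_m$ is the cycle on $m$ vertices. A graph $H$ is a minor of $G$ if a graph isomorphic to $H$ can be obtained from $G$ by repeatedly deleting vertices, deleting edges and contracting edges. For a real $m$, a graph $G$ is $m$-minor-universal if every graph with at most $m$ edges and no isolated vertices is a minor of $G$. -}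

module Defs where

open import Data.Nat using (ℕ; zero; suc; _+_; _*_; _≤_; _<_)
open import Data.Fin using (Fin; zero; suc; toℕ; punchIn; remQuot)
import Data.Fin.Properties as FinP
open import Data.Fin.Properties using (_≟_)
import Data.Nat.Properties as ℕP
open import Data.Product using (Σ; ∃; _×_; _,_; proj₁; proj₂)
open import Data.Sum using (_⊎_; inj₁; inj₂)
open import Data.Empty using (⊥; ⊥-elim)
open import Relation.Nullary using (¬_; Dec; yes; no)
open import Relation.Nullary.Decidable using (_×-dec_; _⊎-dec_; ¬?; isYes)
open import Relation.Binary.PropositionalEquality using (_≡_; refl; _≢_)
import Relation.Binary.PropositionalEquality as PE
open import Data.Bool using (if_then_else_)
open import Function.Bundles using (_↔_; Inverse)

record Graph (n : ℕ) : Set₁ where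
  field
    Adj  : Fin n → Fin n → Set
    adj? : ∀ x y → Dec (Adj x y)
    sym  : ∀ {x y} → Adj x y → Adj y x
    irr  : ∀ {x} → ¬ Adj x x
open Graph public

sumFin : (n : ℕ) → (Fin n → ℕ) → ℕ
sumFin zero    f = 0
sumFin (suc n) f = f zero + sumFin n (λ i → f (suc i))

edgeCount : ∀ {n} → Graph n → ℕ
edgeCount {n} G =
  sumFin n λ x → sumFin n λ y →
    if isYes ((x FinP.<? y) ×-dec adj? G x y) then 1 else 0

NoIsolated : ∀ {n} → Graph n → Set
NoIsolated {n} G = ∀ x → ∃ λ y → Adj G x y

data Walk {n} (G : Graph n) : Fin n → Fin n → Set where
  here : ∀ {x} → Walk G x x
  step : ∀ {x y z} → Adj G x y → Walk G y z → Walk G x z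

Connected : ∀ {n} → Graph n → Set
Connected {n} G = (0 < n) × (∀ x y → Walk G x y)

Iso : ∀ {m n} → Graph m → Graph n → Set
Iso {m} {n} G H =
  Σ (Fin m ↔ Fin n) λ f →
    ∀ x y → (Adj G x y → Adj H (Inverse.to f x) (Inverse.to f y))
          × (Adj H (Inverse.to f x) (Inverse.to f y) → Adj G x y)

deleteVertex : ∀ {n} → Graph (suc n) → Fin (suc n) → Graph n
deleteVertex G i = record
  { Adj  = λ a b → Adj G (punchIn i a) (punchIn i b)
  ; adj? = λ a b → adj? G (punchIn i a) (punchIn i b)
  ; sym  = sym G
  ; irr  = irr G
  }

deleteEdge : ∀ {n} → Graph n → Fin n → Fin n → Graph n
deleteEdge G i j = record
  { Adj  = λ a b → Adj G a b × ¬ ((a ≡ i × b ≡ j) ⊎ (a ≡ j × b ≡ i))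
  ; adj? = λ a b → adj? G a b ×-dec ¬? (((a ≟ i) ×-dec (b ≟ j)) ⊎-dec ((a ≟ j) ×-dec (b ≟ i)))
  ; sym  = λ { (e , ne) → sym G e , λ { (inj₁ (p , q)) → ne (inj₂ (q , p))
                                       ; (inj₂ (p , q)) → ne (inj₁ (q , p)) } }
  ; irr  = λ { (e , _) → irr G e }
  }

-- contract the edge {i,j}: vertex j is merged into vertex i;
-- the vertex a of the new graph corresponds to vertex (punchIn j a).
ContrAdj : ∀ {n} → Graph (suc n) → Fin (suc n) → Fin (suc n) → Fin n → Fin n → Set
ContrAdj G i j a b =
  a ≢ b × (Adj G (punchIn j a) (punchIn j b)
          ⊎ (punchIn j a ≡ i × Adj G j (punchIn j b))
          ⊎ (punchIn j b ≡ i × Adj G (punchIn j a) j))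

contractEdge : ∀ {n} (G : Graph (suc n)) (i j : Fin (suc n)) → Adj G i j → Graph n
contractEdge G i j _ = record
  { Adj  = ContrAdj G i j
  ; adj? = λ a b → ¬? (a ≟ b) ×-dec
             (adj? G (punchIn j a) (punchIn j b)
              ⊎-dec ((punchIn j a ≟ i) ×-dec adj? G j (punchIn j b))
              ⊎-dec ((punchIn j b ≟ i) ×-dec adj? G (punchIn j a) j))
  ; sym  = λ { (ne , inj₁ e) → (λ p → ne (PE.sym p)) , inj₁ (sym G e)
             ; (ne , inj₂ (inj₁ (p , e))) → (λ q → ne (PE.sym q)) , inj₂ (inj₂ (p , sym G e))
             ; (ne , inj₂ (inj₂ (p , e))) → (λ q → ne (PE.sym q)) , inj₂ (inj₁ (p , sym G e)) }
  ; irr  = λ { (ne , _) → ne refl }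
  }

data _⇝_ {m} (G : Graph m) : ∀ {n} → Graph n → Set₁ where
  done     : G ⇝ G
  delVert  : ∀ {n} {H : Graph (suc n)} → G ⇝ H → (i : Fin (suc n)) → G ⇝ deleteVertex H i
  delEdge  : ∀ {n} {H : Graph n} → G ⇝ H → (i j : Fin n) → Adj H i j → G ⇝ deleteEdge H i j
  contract : ∀ {n} {H : Graph (suc n)} → G ⇝ H → (i j : Fin (suc n)) (e : Adj H i j) →
             G ⇝ contractEdge H i j e

_≼_ : ∀ {m n} → Graph m → Graph n → Set₁
_≼_ {m} {n} H G = Σ ℕ λ k → Σ (Graph k) λ G' → (G ⇝ G') × Iso H G'

-- G is minor-universal for edge-bound P: every graph without isolated
-- vertices whose number of edges e satisfies P e is a minor of G.
-- (m-minor-universal for real m corresponds to P e := e ≤ m.)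
MinorUniversalFor : ∀ {n} → Graph n → (ℕ → Set) → Set₁
MinorUniversalFor G P =
  ∀ {m} (H : Graph m) → NoIsolated H → P (edgeCount H) → H ≼ G

_□_ : ∀ {m n} → Graph m → Graph n → Graph (m * n)
_□_ {m} {n} G H = record
  { Adj  = λ x y → PAdj (remQuot n x) (remQuot n y)
  ; adj? = λ x y → let (a , b) = remQuot n x ; (c , d) = remQuot n y in
                   ((a ≟ c) ×-dec adj? H b d) ⊎-dec (adj? G a c ×-dec (b ≟ d))
  ; sym  = λ { (inj₁ (p , e)) → inj₁ (PE.sym p , sym H e)
             ; (inj₂ (e , p)) → inj₂ (sym G e , PE.sym p) }
  ; irr  = λ { (inj₁ (_ , e)) → irr H e ; (inj₂ (e , _)) → irr G e }
  }
  where
  PAdj : Fin m × Fin n → Fin m × Fin n → Set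
  PAdj (a , b) (c , d) = (a ≡ c × Adj H b d) ⊎ (Adj G a c × b ≡ d)

K₁ : Graph 1
K₁ = record { Adj = λ _ _ → ⊥ ; adj? = λ _ _ → no (λ ()) ; sym = λ () ; irr = λ () }

SuccMod : (m : ℕ) → Fin m → Fin m → Set
SuccMod m a b = (suc (toℕ a) ≡ toℕ b) ⊎ (suc (toℕ a) ≡ m × toℕ b ≡ 0)

-- the cycle C_m (for m ≥ 3; used only for such m)
Cycle : (m : ℕ) → Graph m
Cycle m = record
  { Adj  = λ a b → a ≢ b × (SuccMod m a b ⊎ SuccMod m b a)
  ; adj? = λ a b → ¬? (a ≟ b) ×-dec (sm? a b ⊎-dec sm? b a)
  ; sym  = λ { (ne , inj₁ s) → (λ p → ne (PE.sym p)) , inj₂ s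
             ; (ne , inj₂ s) → (λ p → ne (PE.sym p)) , inj₁ s }
  ; irr  = λ { (ne , _) → ne refl }
  }
  where
  sm? : ∀ a b → Dec (SuccMod m a b)
  sm? a b = (suc (toℕ a) ℕP.≟ toℕ b) ⊎-dec ((suc (toℕ a) ℕP.≟ m) ×-dec (toℕ b ℕP.≟ 0))

prodSize : (n : ℕ) → (Fin n → ℕ) → ℕ
prodSize zero    v = 1
prodSize (suc n) v = v zero * prodSize n (λ i → v (suc i))

prodGraph : (n : ℕ) (v : Fin n → ℕ) → ((i : Fin n) → Graph (v i)) → Graph (prodSize n v)
prodGraph zero    v G = K₁
prodGraph (suc n) v G = G zero □ prodGraph n (λ i → v (suc i)) (λ i → G (suc i))

{-# OPTIONS --safe #-}
module Submission where

open import Defs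
open import Data.Nat using (ℕ; zero; suc; _+_; _*_; _∸_; _^_; _≤_; _<_; z≤n; s≤s; _≤?_; _<?_; _⊓_; _⊔_; NonZero; >-nonZero)
import Data.Nat.Properties as ℕP
open import Data.Nat.Solver using (module +-*-Solver)
open +-*-Solver using (solve; _:*_; _:+_; _:=_; con)
open import Data.Fin using (Fin; zero; suc; toℕ; fromℕ<; combine; remQuot; inject≤; punchIn; punchOut; splitAt; _↑ˡ_; _↑ʳ_)
import Data.Fin as F
import Data.Fin.Properties as FP
open import Data.Bool using (if_then_else_)
open import Data.Vec using (Vec; []; _∷_; lookup; tabulate)
open import Data.Vec.Properties using (lookup∘tabulate)
open import Data.List using (List; []; _∷_; _++_; length; map; filter; allFin; cartesianProduct; cartesianProductWith) renaming (lookup to lookupₗ)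
open import Data.List.Properties using (length-++; length-map; length-filter; length-tabulate)
open import Data.List.Relation.Unary.All using (All; []; _∷_)
open import Data.List.Relation.Unary.All.Properties using (all-filter; filter⁺)
open import Data.List.Relation.Unary.Any using (Any; here; there; index)
open import Data.List.Relation.Unary.Any.Properties using (lookup-index)
open import Data.List.Membership.Propositional using (_∈_; find)
open import Data.List.Membership.Propositional.Properties using (∈-allFin; ∈-map⁺; ∈-++⁺ˡ; ∈-++⁺ʳ; ∈-filter⁺; ∈-cartesianProduct⁺; ∈-cartesianProductWith⁺)
import Data.List.Membership.DecPropositional as DecMembership
open import Data.Product using (Σ; ∃; _×_; _,_; proj₁; proj₂)
open import Data.Product.Properties using (≡-dec)
open import Data.Sum using (_⊎_; inj₁; inj₂; [_,_]′)
import Data.Sum as Sum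
open import Data.Unit using (⊤; tt)
open import Data.Empty using (⊥; ⊥-elim)
open import Function.Bundles using (Inverse; mk↔ₛ′)
open import Relation.Nullary using (¬_; Dec; yes; no)
open import Relation.Nullary.Decidable using (_×-dec_; _⊎-dec_; ¬?; isYes)
open import Relation.Binary.Definitions using (DecidableEquality; tri<; tri≈; tri>)
open import Relation.Binary.PropositionalEquality using (_≡_; refl; _≢_; cong; cong₂; subst; subst₂; trans)
import Relation.Binary.PropositionalEquality as PE
open import Relation.Binary.Construct.Closure.ReflexiveTransitive using (Star; ε; _◅_; _◅◅_; gmap; reverse)

-- Universality. Give every edge of H two slots, one per end, placed at distinct points of the product of the Gᵢ. In the
-- cycle layer 0 a slot occupies the whole H₄ × Hₖ fibre over its point. Two copies of the remaining 6n − 3 = 3 (2n − 1)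
-- layers, at two vertices of H₄, carry disjoint routes: one joins the two slots of every edge, the other joins every slot to
-- the next slot of the same vertex of H. The routes exist because a partial permutation of a product of n sets is a
-- composition of 2n − 1 maps that change one coordinate each (Beneš, by König's edge colouring theorem), and a map changing
-- coordinate i needs three layers: a token spreads over the Hₖ fibre of its source, then over the Gᵢ line through it at the
-- height in Hₖ given by its source coordinate, then over the Hₖ fibre of its target.
--
-- Non-universality. The number of nonzero coordinates sorts the product into layers of size w = O(kⁿ / √n), and adjacent
-- vertices lie in the same or in consecutive layers; this bounds the pathwidth of all minors. A graph on 4w vertices with
-- O(w) edges in which any two disjoint sets of w vertices are joined by an edge has larger pathwidth.

-- König's edge colouring theorem

-- The cycle brings every route back: a route leaves layer 0 upwards and its last layer is again
-- adjacent to layer 0, so that source and target can be slots of the same layer. Cutting a vertex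
-- of `H` into one slot per incident edge removes the degrees from the problem: a vertex of any
-- degree becomes a chain of slots, each the source of one route and the target of at most one. This
-- makes both demands partial permutations, which a single routing theorem serves.
--
-- For non-universality the difficulty is the size of the layers. A coordinate is nonzero with
-- probability up to (k - 1) / k, so the weights do not follow a row of Pascal's triangle. Their
-- distribution is treated as a mixture of fair coins: central binomial coefficients are elementary,
-- and the bound survives the mixing by an induction over the coordinates.

-- With ends and colours of edges as `f` and `g` this is properness of a colouring at one side; with
-- labels and positions it says that tokens of equal label stand at distinct points. Passing between
-- the two readings is what turns an edge colouring into a routing.
JointInj : {T A B : Set} → (T → A) → (T → B) → Set
JointInj f g = ∀ {s t} → f s ≡ f t → g s ≡ g t → s ≡ t

module Orbit {t : ℕ} (R : Fin t → Fin t → Set) (R? : ∀ x y → Dec (R x y))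
             (functional : ∀ {x y z} → R x y → R x z → y ≡ z) (start : Fin t) where

  next : Fin t → Fin t
  next x with FP.any? (R? x)
  ... | yes (y , _) = y
  ... | no _        = x

  next-R : ∀ {x y} → R x y → next x ≡ y
  next-R {x} r with FP.any? (R? x)
  ... | yes (_ , r′) = functional r′ r
  ... | no ¬r        = ⊥-elim (¬r (_ , r))

  next-cases : ∀ x → R x (next x) ⊎ next x ≡ x
  next-cases x with FP.any? (R? x)
  ... | yes (_ , r) = inj₁ r
  ... | no _        = inj₂ refl

  orbit : ℕ → Fin t
  orbit zero    = start
  orbit (suc j) = next (orbit j)

  orbit-shift : ∀ d {i j} → orbit i ≡ orbit j → orbit (d + i) ≡ orbit (d + j)
  orbit-shift zero    e = e
  orbit-shift (suc d) e = cong next (orbit-shift d e)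

  InOrbit : Fin t → Set
  InOrbit x = ∃ λ (i : Fin (suc t)) → orbit (toℕ i) ≡ x

  inOrbit? : ∀ x → Dec (InOrbit x)
  inOrbit? x = FP.any? λ i → orbit (toℕ i) FP.≟ x

  orbit∈ : ∀ {j} → j < suc t → InOrbit (orbit j)
  orbit∈ j< = fromℕ< j< , cong orbit (FP.toℕ-fromℕ< j<)

  -- Two of the iterates 0, ..., t coincide, and shifting this coincidence up to index t + 1 gives
  -- an earlier index with the same value. So a bounded, hence decidable, range of indices already
  -- covers the whole orbit.
  wrap : InOrbit (orbit (suc t))
  wrap with FP.pigeonhole (ℕP.n<1+n t) (λ i → orbit (toℕ i))
  ... | i , j , i<j , eq = subst InOrbit same (orbit∈ bound)
    where
    d : ℕ
    d = suc t ∸ toℕ j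
    d+j : d + toℕ j ≡ suc t
    d+j = ℕP.m∸n+n≡m (ℕP.<⇒≤ (FP.toℕ<n j))
    bound : d + toℕ i < suc t
    bound = subst (d + toℕ i <_) d+j (ℕP.+-monoʳ-< d i<j)
    same : orbit (d + toℕ i) ≡ orbit (suc t)
    same = trans (orbit-shift d eq) (cong orbit d+j)

  start∈ : InOrbit start
  start∈ = orbit∈ (s≤s z≤n)

  closed : ∀ {x y} → InOrbit x → R x y → InOrbit y
  closed {x} {y} (i , refl) r with toℕ i ℕP.<? t
  ... | yes i<t = subst InOrbit (next-R r) (orbit∈ (s≤s i<t))
  ... | no  i≮t = subst InOrbit (trans (cong orbit (cong suc (PE.sym i≡t))) (next-R r)) wrap
    where
    i≡t : toℕ i ≡ t
    i≡t = ℕP.≤-antisym (ℕP.≤-pred (FP.toℕ<n i)) (ℕP.≮⇒≥ i≮t)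

  -- Where the relation has no successor, `next` stands still; such idle steps are skipped backwards
  -- until a genuine step or the start is reached.
  predecessor : ∀ {x} → InOrbit x → x ≡ start ⊎ ∃ λ z → InOrbit z × R z x
  predecessor (i , refl) = go (toℕ i) (FP.toℕ<n i)
    where
    go : ∀ j → j < suc t → orbit j ≡ start ⊎ ∃ λ z → InOrbit z × R z (orbit j)
    go zero    _  = inj₁ refl
    go (suc j) j< with next-cases (orbit j)
    ... | inj₁ r  = inj₂ (orbit j , orbit∈ (ℕP.<⇒≤ j<) , r)
    ... | inj₂ eq = subst (λ x → x ≡ start ⊎ ∃ λ z → InOrbit z × R z x) (PE.sym eq) (go j (ℕP.<⇒≤ j<))

-- If all Δ colours occurred at `l zero`, one edge of each colour together with edge zero would be Δ
-- + 1 edges at this vertex, and the numbering `a` would give two of them the same number.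
freeColour : ∀ {A : Set} (_≟_ : DecidableEquality A) {t Δ} (l : Fin (suc t) → A) (a : Fin (suc t) → Fin Δ) →
             JointInj l a → (c : Fin t → Fin Δ) →
             ∃ λ α → ∀ τ → l (suc τ) ≡ l zero → c τ ≢ α
freeColour _≟_ {t} {Δ} l a inj c with FP.all? (λ α → FP.any? λ τ → (l (suc τ) ≟ l zero) ×-dec (c τ FP.≟ α))
... | no ¬all with FP.¬∀⟶∃¬ Δ _ (λ α → FP.any? λ τ → (l (suc τ) ≟ l zero) ×-dec (c τ FP.≟ α)) ¬all
...   | α , unused = α , λ τ e c≡α → unused (τ , e , c≡α)
freeColour _≟_ {t} {Δ} l a inj c | yes used with FP.pigeonhole (ℕP.n<1+n Δ) port
  where
  port : Fin (suc Δ) → Fin Δ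
  port zero    = a zero
  port (suc α) = a (suc (proj₁ (used α)))
... | zero , suc β , _ , eq with inj (PE.sym (proj₁ (proj₂ (used β)))) eq
...   | ()
freeColour _≟_ l a inj c | yes used | suc α , suc β , s≤s α<β , eq
  with used α | used β
... | τ , lτ , cτ | σ , lσ , cσ with inj (trans lτ (PE.sym lσ)) eq
...   | refl = ⊥-elim (ℕP.<⇒≢ α<β (cong toℕ (trans (PE.sym cτ) cσ)))

module Kempe {A B : Set} {t Δ : ℕ} (l : Fin (suc t) → A) (r : Fin (suc t) → B)
             (_≟A_ : DecidableEquality A) (_≟B_ : DecidableEquality B)
             (c : Fin t → Fin Δ)
             (injₗ : JointInj (λ τ → l (suc τ)) c) (injᵣ : JointInj (λ τ → r (suc τ)) c)
             (α β : Fin Δ)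
             (freeα : ∀ τ → l (suc τ) ≡ l zero → c τ ≢ α)
             (freeβ : ∀ τ → r (suc τ) ≡ r zero → c τ ≢ β) where

  private
    lt : Fin t → A
    lt τ = l (suc τ)
    rt : Fin t → B
    rt τ = r (suc τ)

  -- Exchanging α and β along the chain that starts with the α-edge y at r zero makes α free there; the chain cannot reach
  -- l zero, since it would arrive by an α-edge.
  module Flip (y : Fin t) (ry : rt y ≡ r zero) (cy : c y ≡ α) where

    α≢β : α ≢ β
    α≢β e = freeβ y ry (trans cy e)

    -- The alternating path has a direction because the graph is bipartite: coming from `r zero`, it
    -- runs from right to left along α-edges and from left to right along β-edges. The colour of an
    -- edge therefore decides at which end the path continues.
    Next : Fin t → Fin t → Set
    Next τ σ = (c τ ≡ α × lt σ ≡ lt τ × c σ ≡ β) ⊎ (c τ ≡ β × rt σ ≡ rt τ × c σ ≡ α)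

    next? : ∀ τ σ → Dec (Next τ σ)
    next? τ σ = ((c τ FP.≟ α) ×-dec (lt σ ≟A lt τ) ×-dec (c σ FP.≟ β))
          ⊎-dec ((c τ FP.≟ β) ×-dec (rt σ ≟B rt τ) ×-dec (c σ FP.≟ α))

    functional : ∀ {x y z} → Next x y → Next x z → y ≡ z
    functional (inj₁ (_ , p , q)) (inj₁ (_ , p′ , q′)) = injₗ (trans p (PE.sym p′)) (trans q (PE.sym q′))
    functional (inj₁ (a , _)) (inj₂ (b , _)) = ⊥-elim (α≢β (trans (PE.sym a) b))
    functional (inj₂ (b , _)) (inj₁ (a , _)) = ⊥-elim (α≢β (trans (PE.sym a) b))
    functional (inj₂ (_ , p , q)) (inj₂ (_ , p′ , q′)) = injᵣ (trans p (PE.sym p′)) (trans q (PE.sym q′))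

    open Orbit Next next? functional y

    Flipped : Fin t → Fin Δ → Set
    Flipped τ γ = (c τ ≡ α × γ ≡ β) ⊎ (c τ ≡ β × γ ≡ α)

    Recoloured : Fin t → Fin Δ → Set
    Recoloured τ γ = (InOrbit τ × Flipped τ γ) ⊎ (¬ InOrbit τ × γ ≡ c τ)

    recolour : ∀ τ → ∃ (Recoloured τ)
    recolour τ with inOrbit? τ
    ... | no τ∉ = c τ , inj₂ (τ∉ , refl)
    -- That an edge of the chain has colour α or β is read off from the step that leads to it.
    ... | yes τ∈ with predecessor τ∈
    ...   | inj₁ refl = β , inj₁ (τ∈ , inj₁ (cy , refl))
    ...   | inj₂ (_ , _ , inj₁ (_ , _ , e)) = α , inj₁ (τ∈ , inj₂ (e , refl))
    ...   | inj₂ (_ , _ , inj₂ (_ , _ , e)) = β , inj₁ (τ∈ , inj₁ (e , refl))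

    c⁺ : Fin (suc t) → Fin Δ
    c⁺ zero    = α
    c⁺ (suc τ) = proj₁ (recolour τ)

    flipped-inj : ∀ {τ σ γ} → Flipped τ γ → Flipped σ γ → c τ ≡ c σ
    flipped-inj (inj₁ (p , _)) (inj₁ (q , _)) = trans p (PE.sym q)
    flipped-inj (inj₁ (_ , p)) (inj₂ (_ , q)) = ⊥-elim (α≢β (trans (PE.sym q) p))
    flipped-inj (inj₂ (_ , p)) (inj₁ (_ , q)) = ⊥-elim (α≢β (trans (PE.sym p) q))
    flipped-inj (inj₂ (p , _)) (inj₂ (q , _)) = trans p (PE.sym q)

    -- The only edges whose colour can clash with a flipped edge are its neighbours on the chain,
    -- the next one after an α-edge and the previous one before a β-edge; these are flipped as well.
    orbit-closedₗ : ∀ {τ σ} → InOrbit τ → Flipped τ (c σ) → lt τ ≡ lt σ → InOrbit σ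
    orbit-closedₗ τ∈ (inj₁ (p , q)) e = closed τ∈ (inj₁ (p , PE.sym e , q))
    orbit-closedₗ τ∈ (inj₂ (p , q)) e with predecessor τ∈
    ... | inj₁ refl = ⊥-elim (α≢β (trans (PE.sym cy) p))
    ... | inj₂ (z , z∈ , inj₁ (cz , lz , _)) = subst InOrbit (injₗ (trans (PE.sym lz) e) (trans cz (PE.sym q))) z∈
    ... | inj₂ (_ , _ , inj₂ (_ , _ , p′))  = ⊥-elim (α≢β (trans (PE.sym p′) p))

    orbit-closedᵣ : ∀ {τ σ} → InOrbit τ → Flipped τ (c σ) → rt τ ≡ rt σ → InOrbit σ
    orbit-closedᵣ τ∈ (inj₂ (p , q)) e = closed τ∈ (inj₂ (p , PE.sym e , q))
    orbit-closedᵣ {σ = σ} τ∈ (inj₁ (p , q)) e with predecessor τ∈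
    -- At its right end the first edge has no neighbour on the chain; there the clash is excluded
    -- because β is free at `r zero`.
    ... | inj₁ refl = ⊥-elim (freeβ σ (trans (PE.sym e) ry) q)
    ... | inj₂ (z , z∈ , inj₂ (cz , rz , _)) = subst InOrbit (injᵣ (trans (PE.sym rz) e) (trans cz (PE.sym q))) z∈
    ... | inj₂ (_ , _ , inj₁ (_ , _ , p′))  = ⊥-elim (α≢β (trans (PE.sym p) p′))

    tail-inj : ∀ {C : Set} (f : Fin t → C) → JointInj f c →
               (∀ {τ σ} → InOrbit τ → Flipped τ (c σ) → f τ ≡ f σ → InOrbit σ) →
               ∀ {τ σ γ} → f τ ≡ f σ → Recoloured τ γ → Recoloured σ γ → τ ≡ σ
    tail-inj f inj clos e (inj₁ (_ , x)) (inj₁ (_ , y)) = inj e (flipped-inj x y)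
    tail-inj f inj clos e (inj₁ (τ∈ , x)) (inj₂ (τ∉ , refl)) = ⊥-elim (τ∉ (clos τ∈ x e))
    tail-inj f inj clos e (inj₂ (τ∉ , refl)) (inj₁ (τ∈ , x)) = ⊥-elim (τ∉ (clos τ∈ x (PE.sym e)))
    tail-inj f inj clos e (inj₂ (_ , x)) (inj₂ (_ , y)) = inj e (trans (PE.sym x) y)

    head-freeₗ : ∀ {τ γ} → lt τ ≡ l zero → Recoloured τ γ → γ ≢ α
    head-freeₗ {τ} e (inj₂ (_ , refl)) p = freeα τ e p
    head-freeₗ e (inj₁ (_ , inj₁ (_ , q))) p = α≢β (trans (PE.sym p) q)
    head-freeₗ e (inj₁ (τ∈ , inj₂ (q , _))) _ with predecessor τ∈
    ... | inj₁ refl = α≢β (trans (PE.sym cy) q)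
    ... | inj₂ (z , _ , inj₁ (cz , lz , _)) = freeα z (trans (PE.sym lz) e) cz
    ... | inj₂ (_ , _ , inj₂ (_ , _ , p′)) = α≢β (trans (PE.sym p′) q)

    head-freeᵣ : ∀ {τ γ} → rt τ ≡ r zero → Recoloured τ γ → γ ≢ α
    -- The only α-edge at `r zero` is `y`, and it has been flipped.
    head-freeᵣ e (inj₂ (τ∉ , refl)) p = τ∉ (subst InOrbit (injᵣ (trans ry (PE.sym e)) (trans cy (PE.sym p))) start∈)
    head-freeᵣ e (inj₁ (_ , inj₁ (_ , q))) p = α≢β (trans (PE.sym p) q)
    head-freeᵣ {τ} e (inj₁ (_ , inj₂ (q , _))) _ = freeβ τ e q

    c⁺-injₗ : JointInj l c⁺
    c⁺-injₗ {zero}  {zero}  _ _ = refl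
    c⁺-injₗ {zero}  {suc τ} e p = ⊥-elim (head-freeₗ (PE.sym e) (proj₂ (recolour τ)) (PE.sym p))
    c⁺-injₗ {suc τ} {zero}  e p = ⊥-elim (head-freeₗ e (proj₂ (recolour τ)) p)
    c⁺-injₗ {suc τ} {suc σ} e p = cong suc (tail-inj lt injₗ orbit-closedₗ e (proj₂ (recolour τ))
                                    (subst (Recoloured σ) (PE.sym p) (proj₂ (recolour σ))))

    c⁺-injᵣ : JointInj r c⁺
    c⁺-injᵣ {zero}  {zero}  _ _ = refl
    c⁺-injᵣ {zero}  {suc τ} e p = ⊥-elim (head-freeᵣ (PE.sym e) (proj₂ (recolour τ)) (PE.sym p))
    c⁺-injᵣ {suc τ} {zero}  e p = ⊥-elim (head-freeᵣ e (proj₂ (recolour τ)) p)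
    c⁺-injᵣ {suc τ} {suc σ} e p = cong suc (tail-inj rt injᵣ orbit-closedᵣ e (proj₂ (recolour τ))
                                    (subst (Recoloured σ) (PE.sym p) (proj₂ (recolour σ))))

  extend : ∃ λ (c⁺ : Fin (suc t) → Fin Δ) → JointInj l c⁺ × JointInj r c⁺
  extend with FP.any? (λ τ → (rt τ ≟B r zero) ×-dec (c τ FP.≟ α))
  ... | yes (y , ry , cy) = Flip.c⁺ y ry cy , Flip.c⁺-injₗ y ry cy , Flip.c⁺-injᵣ y ry cy
  ... | no unused = c⁺ , consInj l injₗ freeα , consInj r injᵣ (λ τ e p → unused (τ , e , p))
    where
    c⁺ : Fin (suc t) → Fin Δ
    c⁺ zero    = α
    c⁺ (suc τ) = c τ
    consInj : ∀ {C : Set} (f : Fin (suc t) → C) → JointInj (λ τ → f (suc τ)) c →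
              (∀ τ → f (suc τ) ≡ f zero → c τ ≢ α) → JointInj f c⁺
    consInj f inj free {zero}  {zero}  _ _ = refl
    consInj f inj free {zero}  {suc τ} e p = ⊥-elim (free τ (PE.sym e) (PE.sym p))
    consInj f inj free {suc τ} {zero}  e p = ⊥-elim (free τ e p)
    consInj f inj free {suc τ} {suc σ} e p = cong suc (inj e p)

-- The edges are Fin t, with ends l and r; that all degrees are at most Δ is expressed by numberings a and b of the edges
-- at every vertex.
könig : ∀ {A B : Set} → DecidableEquality A → DecidableEquality B →
        ∀ {Δ} t (l : Fin t → A) (r : Fin t → B) (a b : Fin t → Fin Δ) →
        JointInj l a → JointInj r b →
        ∃ λ (c : Fin t → Fin Δ) → JointInj l c × JointInj r c
könig _≟A_ _≟B_ zero l r a b la rb = (λ ()) , (λ { {()} }) , (λ { {()} })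
könig _≟A_ _≟B_ (suc t) l r a b la rb
  with könig _≟A_ _≟B_ t (λ τ → l (suc τ)) (λ τ → r (suc τ)) (λ τ → a (suc τ)) (λ τ → b (suc τ))
         (λ e p → FP.suc-injective (la e p)) (λ e p → FP.suc-injective (rb e p))
... | c , lc , rc
  with freeColour _≟A_ l a la c | freeColour _≟B_ r b rb c
... | α , freeα | β , freeβ = Kempe.extend l r _≟A_ _≟B_ c lc rc α β freeα freeβ

-- Routing in products

□-adjˡ : ∀ {m n} (G : Graph m) (H : Graph n) a c b → Adj G a c → Adj (G □ H) (combine a b) (combine c b)
□-adjˡ G H a c b e =
  inj₂ (subst₂ (Adj G) (PE.sym (cong proj₁ (FP.remQuot-combine a b))) (PE.sym (cong proj₁ (FP.remQuot-combine c b))) e ,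
        trans (cong proj₂ (FP.remQuot-combine a b)) (PE.sym (cong proj₂ (FP.remQuot-combine c b))))

□-adjʳ : ∀ {m n} (G : Graph m) (H : Graph n) a b d → Adj H b d → Adj (G □ H) (combine a b) (combine a d)
□-adjʳ G H a b d e =
  inj₁ (trans (cong proj₁ (FP.remQuot-combine a b)) (PE.sym (cong proj₁ (FP.remQuot-combine a d))) ,
        subst₂ (Adj H) (PE.sym (cong proj₂ (FP.remQuot-combine a b))) (PE.sym (cong proj₂ (FP.remQuot-combine a d))) e)

walkMap : ∀ {n} {G : Graph n} {V : Set} {E : V → V → Set} (f : Fin n → V) →
          (∀ {a b} → Adj G a b → E (f a) (f b)) → ∀ {a b} → Walk G a b → Star E (f a) (f b)
walkMap f g here       = ε
walkMap f g (step e w) = g e ◅ walkMap f g w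

Within : ∀ {V : Set} → (V → V → Set) → (V → Set) → V → V → Set
Within E P x y = E x y × P x × P y

Point : (n : ℕ) → (Fin n → ℕ) → Set
Point n v = Fin (prodSize n v)

head : ∀ n v → Point (suc n) v → Fin (v zero)
head n v x = proj₁ (remQuot {v zero} (prodSize n (λ i → v (suc i))) x)

tail : ∀ n v → Point (suc n) v → Point n (λ i → v (suc i))
tail n v x = proj₂ (remQuot {v zero} (prodSize n (λ i → v (suc i))) x)

head-combine : ∀ n v (a : Fin (v zero)) b → head n v (combine a b) ≡ a
head-combine n v a b = cong proj₁ (FP.remQuot-combine a b)

tail-combine : ∀ n v (a : Fin (v zero)) b → tail n v (combine a b) ≡ b
tail-combine n v a b = cong proj₂ (FP.remQuot-combine a b)

combine-head-tail : ∀ n v x → combine (head n v x) (tail n v x) ≡ x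
combine-head-tail n v x = FP.combine-remQuot {v zero} (prodSize n (λ i → v (suc i))) x

point-≡ : ∀ n v {x y} → head n v x ≡ head n v y → tail n v x ≡ tail n v y → x ≡ y
point-≡ n v {x} {y} p q = trans (PE.sym (combine-head-tail n v x)) (trans (cong₂ combine p q) (combine-head-tail n v y))

Line : ∀ n v → Fin n → Point n v → Point n v → Set
Line (suc n) v zero    x y = tail n v x ≡ tail n v y
Line (suc n) v (suc i) x y = head n v x ≡ head n v y × Line n (λ j → v (suc j)) i (tail n v x) (tail n v y)

coord : ∀ n v (i : Fin n) → Point n v → Fin (v i)
coord (suc n) v zero    x = head n v x
coord (suc n) v (suc i) x = coord n (λ j → v (suc j)) i (tail n v x)

line? : ∀ n v i x y → Dec (Line n v i x y)
line? (suc n) v zero    x y = tail n v x FP.≟ tail n v y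
line? (suc n) v (suc i) x y = (head n v x FP.≟ head n v y) ×-dec line? n (λ j → v (suc j)) i (tail n v x) (tail n v y)

line-refl : ∀ n v i x → Line n v i x x
line-refl (suc n) v zero    x = refl
line-refl (suc n) v (suc i) x = refl , line-refl n (λ j → v (suc j)) i (tail n v x)

line-euclid : ∀ n v i {x y z} → Line n v i x z → Line n v i y z → Line n v i x y
line-euclid (suc n) v zero    p q = trans p (PE.sym q)
line-euclid (suc n) v (suc i) (p , p′) (q , q′) = trans p (PE.sym q) , line-euclid n (λ j → v (suc j)) i p′ q′

line-coord : ∀ n v i {x y} → Line n v i x y → coord n v i x ≡ coord n v i y → x ≡ y
line-coord (suc n) v zero    p q = point-≡ n v q p
line-coord (suc n) v (suc i) (p , p′) q = point-≡ n v p (line-coord n (λ j → v (suc j)) i p′ q)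

line-connected : ∀ n v (G : ∀ i → Graph (v i)) → (∀ i → Connected (G i)) → ∀ i {x y} → Line n v i x y →
                 Star (Within (Adj (prodGraph n v G)) (Line n v i x)) x y
line-connected (suc n) v G conn zero {x} {y} p =
  subst₂ (Star (Within (Adj (prodGraph (suc n) v G)) (Line (suc n) v zero x)))
    (combine-head-tail n v x) (trans (cong (combine (head n v y)) p) (combine-head-tail n v y))
    (walkMap (λ a → combine a (tail n v x))
      (λ e → □-adjˡ (G zero) (prodGraph n (λ j → v (suc j)) (λ j → G (suc j))) _ _ _ e , PE.sym (tail-combine n v _ _) , PE.sym (tail-combine n v _ _))
      (proj₂ (conn zero) (head n v x) (head n v y)))
line-connected (suc n) v G conn (suc i) {x} {y} (p , p′) =
  subst₂ (Star (Within (Adj (prodGraph (suc n) v G)) (Line (suc n) v (suc i) x)))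
    (combine-head-tail n v x) (trans (cong (λ a → combine a (tail n v y)) p) (combine-head-tail n v y))
    (gmap (combine (head n v x))
      (λ { (e , a , b) → □-adjʳ (G zero) (prodGraph n (λ j → v (suc j)) (λ j → G (suc j))) _ _ _ e , onLine a , onLine b })
      (line-connected n (λ j → v (suc j)) (λ j → G (suc j)) (λ j → conn (suc j)) i p′))
  where
  onLine : ∀ {b} → Line n (λ j → v (suc j)) i (tail n v x) b → Line (suc n) v (suc i) x (combine (head n v x) b)
  onLine {b} l = PE.sym (head-combine n v _ b) ,
                 subst (Line n (λ j → v (suc j)) i (tail n v x)) (PE.sym (tail-combine n v _ b)) l

-- The label records the coordinates that are held fixed. Tokens with different labels live in
-- different fibres and may share a point of the remaining product, so that one route serves all
-- fibres simultaneously.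
data Route {t} {Λ : Set} (lab : Fin t → Λ) (n : ℕ) (v : Fin n → ℕ) : ℕ → (p q : Fin t → Point n v) → Set where
  one  : ∀ {p q} i → (∀ τ → Line n v i (p τ) (q τ)) → Route lab n v 1 p q
  cons : ∀ {m p q} i mid → (∀ τ → Line n v i (p τ) (mid τ)) → JointInj lab mid →
         Route lab n v m mid q → Route lab n v (suc m) p q

snoc : ∀ {t Λ} {lab : Fin t → Λ} {n v m p q} → Route lab n v m p q → JointInj lab q →
       ∀ i {r} → (∀ τ → Line n v i (q τ) (r τ)) → Route lab n v (suc m) p r
snoc (one i l)         inj j l′ = cons i _ l inj (one j l′)
snoc (cons i mid l injₘ R) inj j l′ = cons i mid l injₘ (snoc R inj j l′)

lift : ∀ {t Λ} {lab : Fin t → Λ} {n v m} (c : Fin t → Fin (v zero)) {p q} →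
       Route (λ τ → lab τ , c τ) n (λ i → v (suc i)) m p q →
       Route lab (suc n) v m (λ τ → combine (c τ) (p τ)) (λ τ → combine (c τ) (q τ))
lift {n = n} {v} c {p} {q} = go
  where
  line⁺ : ∀ i {p q : Fin _ → Point n (λ i → v (suc i))} → (∀ τ → Line n (λ i → v (suc i)) i (p τ) (q τ)) →
          ∀ τ → Line (suc n) v (suc i) (combine (c τ) (p τ)) (combine (c τ) (q τ))
  line⁺ i {p} {q} l τ =
    trans (head-combine n v (c τ) (p τ)) (PE.sym (head-combine n v (c τ) (q τ))) ,
    subst₂ (Line n (λ i → v (suc i)) i) (PE.sym (tail-combine n v (c τ) (p τ))) (PE.sym (tail-combine n v (c τ) (q τ))) (l τ)
  go : ∀ {m p q} → Route (λ τ → _ , c τ) n (λ i → v (suc i)) m p q →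
       Route _ (suc n) v m (λ τ → combine (c τ) (p τ)) (λ τ → combine (c τ) (q τ))
  go (one i l) = one (suc i) (line⁺ i l)
  go (cons i mid l inj R) = cons (suc i) (λ τ → combine (c τ) (mid τ)) (line⁺ i l)
    (λ {σ} {τ} e f → let (g , h) = FP.combine-injective (c σ) (mid σ) (c τ) (mid τ) f in inj (cong₂ _,_ e g) h)
    (go R)

-- The argument is one less than the number of factors: N factors take 2 N - 1 stages.
stages : ℕ → ℕ
stages zero    = 1
stages (suc n) = suc (suc (stages n))

-- Every token is an edge from the fibre of its source to the fibre of its target, a fibre being a
-- label with a tail. The heads number the edges at a fibre, so König's theorem colours them with
-- the values of coordinate zero. The colour is the value held in the middle: properness at the
-- sources makes the first move injective, properness at the targets does so before the last one,
-- and within one colour the tails are distinct, as the recursion requires.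
beneš : ∀ n v {t} {Λ : Set} → DecidableEquality Λ → (lab : Fin t → Λ) (p q : Fin t → Point (suc n) v) →
        JointInj lab p → JointInj lab q → Route lab (suc n) v (stages n) p q
-- A single factor forms one line, the tails being points of the empty product.
beneš zero v _≟_ lab p q injp injq = one zero (λ τ → Fin1 _ _)
  where
  Fin1 : (a b : Fin 1) → a ≡ b
  Fin1 zero zero = refl
beneš (suc n) v {t} {Λ} _≟_ lab p q injp injq
  with könig (≡-dec _≟_ FP._≟_) (≡-dec _≟_ FP._≟_) t
         (λ τ → lab τ , tail (suc n) v (p τ)) (λ τ → lab τ , tail (suc n) v (q τ))
         (λ τ → head (suc n) v (p τ)) (λ τ → head (suc n) v (q τ))
         (λ e f → injp (cong proj₁ e) (point-≡ (suc n) v f (cong proj₂ e)))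
         (λ e f → injq (cong proj₁ e) (point-≡ (suc n) v f (cong proj₂ e)))
... | c , cp , cq =
  cons zero (λ τ → combine (c τ) (pt τ)) (λ τ → PE.sym (tail-combine (suc n) v _ _)) (mid-inj pt cp)
    (snoc (lift c (beneš n (λ i → v (suc i)) (≡-dec _≟_ FP._≟_) (λ τ → lab τ , c τ) pt qt (swap-inj cp) (swap-inj cq)))
      (mid-inj qt cq) zero (λ τ → tail-combine (suc n) v _ _))
  where
  pt qt : Fin t → Point (suc n) (λ i → v (suc i))
  pt τ = tail (suc n) v (p τ)
  qt τ = tail (suc n) v (q τ)
  swap-inj : ∀ {r : Fin t → Point (suc n) (λ i → v (suc i))} →
             JointInj (λ τ → lab τ , r τ) c → JointInj (λ τ → lab τ , c τ) r
  swap-inj inj e f = inj (cong₂ _,_ (cong proj₁ e) f) (cong proj₂ e)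
  mid-inj : ∀ (r : Fin t → Point (suc n) (λ i → v (suc i))) → JointInj (λ τ → lab τ , r τ) c →
            JointInj lab (λ τ → combine (c τ) (r τ))
  mid-inj r inj {σ} {τ} e f = let (g , h) = FP.combine-injective (c σ) (r σ) (c τ) (r τ) f in inj (cong₂ _,_ e h) g

-- Disjoint networks along a route.

Cell : ℕ → ℕ → Set
Cell k N = ℕ × Fin k × Fin N

data LayerAdj {k N} (H : Graph k) (G : Graph N) : Cell k N → Cell k N → Set where
  inH  : ∀ {ℓ h h′ x} → Adj H h h′ → LayerAdj H G (ℓ , h , x) (ℓ , h′ , x)
  inG  : ∀ {ℓ h x x′} → Adj G x x′ → LayerAdj H G (ℓ , h , x) (ℓ , h , x′)
  up   : ∀ {ℓ h x} → LayerAdj H G (ℓ , h , x) (suc ℓ , h , x)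
  down : ∀ {ℓ h x} → LayerAdj H G (suc ℓ , h , x) (ℓ , h , x)

-- The set `Occ τ` later becomes a connected piece of a branch set. It contains whole `H`-fibres at
-- both ends, so that pieces can be glued at any height without matching heights.
record Network {k N t} (H : Graph k) (G : Graph N) (p q : Fin t → Fin N) (top : ℕ) : Set₁ where
  field
    Occ      : Fin t → Cell k N → Set
    occ?     : ∀ τ z → Dec (Occ τ z)
    disjoint : ∀ {σ τ z} → Occ σ z → Occ τ z → σ ≡ τ
    bounded  : ∀ {τ z} → Occ τ z → proj₁ z ≤ top
    entry    : ∀ τ h → Occ τ (0 , h , p τ)
    exit     : ∀ τ h → Occ τ (top , h , q τ)
    linked   : ∀ {τ z} → Occ τ z → ∀ h → Star (Within (LayerAdj H G) (Occ τ)) (0 , h , p τ) z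

module Realise {t n k : ℕ} (v : Fin n → ℕ) (G : ∀ i → Graph (v i)) (conG : ∀ i → Connected (G i))
               (v≤k : ∀ i → v i ≤ k) (H : Graph k) (conH : Connected H) where

  PG : Graph (prodSize n v)
  PG = prodGraph n v G

  unlabelled : Fin t → ⊤
  unlabelled _ = tt

  E : Cell k (prodSize n v) → Cell k (prodSize n v) → Set
  E = LayerAdj H PG

  Stage : (p q : Fin t → Point n v) → Fin n → Fin t → Cell k (prodSize n v) → Set
  Stage p q i τ (0 , h , x) = x ≡ p τ
  Stage p q i τ (1 , h , x) = toℕ h ≡ toℕ (coord n v i (p τ)) × Line n v i (p τ) x
  Stage p q i τ (2 , h , x) = x ≡ q τ
  Stage p q i τ (suc (suc (suc _)) , h , x) = ⊥

  stage? : ∀ p q i τ z → Dec (Stage p q i τ z)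
  stage? p q i τ (0 , h , x) = x FP.≟ p τ
  stage? p q i τ (1 , h , x) = (toℕ h ℕP.≟ toℕ (coord n v i (p τ))) ×-dec line? n v i (p τ) x
  stage? p q i τ (2 , h , x) = x FP.≟ q τ
  stage? p q i τ (suc (suc (suc _)) , h , x) = no λ ()

  -- In the middle layer a common cell means a common line and a common height. The height is the
  -- source coordinate on that line, so the sources agree.
  stage-disjoint : ∀ {p q} i → JointInj unlabelled p → JointInj unlabelled q →
                   ∀ {σ τ z} → Stage p q i σ z → Stage p q i τ z → σ ≡ τ
  stage-disjoint i ip iq {z = 0 , _} a b = ip refl (trans (PE.sym a) b)
  stage-disjoint i ip iq {z = 1 , _} (a , a′) (b , b′) =
    ip refl (line-coord n v i (line-euclid n v i a′ b′) (FP.toℕ-injective (trans (PE.sym a) b)))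
  stage-disjoint i ip iq {z = 2 , _} a b = iq refl (trans (PE.sym a) b)

  stage-bounded : ∀ {p q i τ z} → Stage p q i τ z → proj₁ z ≤ 2
  stage-bounded {z = 0 , _} _ = z≤n
  stage-bounded {z = 1 , _} _ = s≤s z≤n
  stage-bounded {z = 2 , _} _ = s≤s (s≤s z≤n)

  stage-linked : ∀ {p q i} → (∀ τ → Line n v i (p τ) (q τ)) → ∀ {τ z} → Stage p q i τ z →
                 ∀ h → Star (Within E (Stage p q i τ)) (0 , h , p τ) z
  stage-linked {p} {q} {i} line {τ} occ h = go _ occ
    where
    -- Here `v i ≤ k` enters: the fibre has a separate height for each point of a line.
    h* : Fin k
    h* = inject≤ (coord n v i (p τ)) (v≤k i)
    h*≡ : toℕ h* ≡ toℕ (coord n v i (p τ))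
    h*≡ = FP.toℕ-inject≤ (coord n v i (p τ)) (v≤k i)
    Conn : Cell k (prodSize n v) → Cell k (prodSize n v) → Set
    Conn = Star (Within E (Stage p q i τ))
    layer₀ : ∀ h′ → Conn (0 , h , p τ) (0 , h′ , p τ)
    layer₀ h′ = walkMap (λ a → 0 , a , p τ) (λ e → inH e , refl , refl) (proj₂ conH h h′)
    layer₁ : ∀ {x} → Line n v i (p τ) x → Conn (1 , h* , p τ) (1 , h* , x)
    layer₁ l = gmap (λ a → 1 , h* , a) (λ { (e , a , b) → inG e , (h*≡ , a) , (h*≡ , b) }) (line-connected n v G conG i l)
    layer₂ : ∀ h′ → Conn (2 , h* , q τ) (2 , h′ , q τ)
    layer₂ h′ = walkMap (λ a → 2 , a , q τ) (λ e → inH e , refl , refl) (proj₂ conH h* h′)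
    to₁ : ∀ {x} → Line n v i (p τ) x → Conn (0 , h , p τ) (1 , h* , x)
    to₁ l = layer₀ h* ◅◅ ((up , refl , (h*≡ , line-refl n v i _)) ◅ layer₁ l)
    go : ∀ z → Stage p q i τ z → Conn (0 , h , p τ) z
    go (0 , h′ , x) refl = layer₀ h′
    go (1 , h′ , x) (a , l) = subst (λ a → Conn (0 , h , p τ) (1 , a , x)) (FP.toℕ-injective (trans h*≡ (PE.sym a))) (to₁ l)
    go (2 , h′ , x) refl = to₁ (line τ) ◅◅ ((up , (h*≡ , line τ) , refl) ◅ layer₂ h′)

  Occupied : ∀ {m p q} → Route unlabelled n v m p q → Fin t → Cell k (prodSize n v) → Set
  Occupied (one {p} {q} i _) τ z = Stage p q i τ z
  Occupied (cons {p = p} i mid _ _ R) τ (0 , h , x) = Stage p mid i τ (0 , h , x)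
  Occupied (cons {p = p} i mid _ _ R) τ (1 , h , x) = Stage p mid i τ (1 , h , x)
  Occupied (cons {p = p} i mid _ _ R) τ (2 , h , x) = Stage p mid i τ (2 , h , x)
  Occupied (cons i mid _ _ R) τ (suc (suc (suc ℓ)) , h , x) = Occupied R τ (ℓ , h , x)

  occupied? : ∀ {m p q} (R : Route unlabelled n v m p q) τ z → Dec (Occupied R τ z)
  occupied? (one i _) τ z = stage? _ _ i τ z
  occupied? (cons {p = p} i mid _ _ R) τ (0 , h , x) = stage? p mid i τ (0 , h , x)
  occupied? (cons {p = p} i mid _ _ R) τ (1 , h , x) = stage? p mid i τ (1 , h , x)
  occupied? (cons {p = p} i mid _ _ R) τ (2 , h , x) = stage? p mid i τ (2 , h , x)
  occupied? (cons i mid _ _ R) τ (suc (suc (suc ℓ)) , h , x) = occupied? R τ (ℓ , h , x)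

  stage⇒occupied : ∀ {m p q i mid} {l : ∀ τ → Line n v i (p τ) (mid τ)} {inj : JointInj unlabelled mid} {R : Route unlabelled n v m mid q} {τ z} →
                   Stage p mid i τ z → Occupied (cons {q = q} i mid l (λ {s} {t} → inj {s} {t}) R) τ z
  stage⇒occupied {z = 0 , _} s = s
  stage⇒occupied {z = 1 , _} s = s
  stage⇒occupied {z = 2 , _} s = s

  occupied-disjoint : ∀ {m p q} (R : Route unlabelled n v m p q) → JointInj unlabelled p → JointInj unlabelled q →
                      ∀ {σ τ z} → Occupied R σ z → Occupied R τ z → σ ≡ τ
  occupied-disjoint (one i _) ip iq a b = stage-disjoint i ip iq a b
  occupied-disjoint (cons {p = p} i mid _ im R) ip iq {z = z@(0 , _)} a b = stage-disjoint {p} {mid} i ip im {z = z} a b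
  occupied-disjoint (cons {p = p} i mid _ im R) ip iq {z = z@(1 , _)} a b = stage-disjoint {p} {mid} i ip im {z = z} a b
  occupied-disjoint (cons {p = p} i mid _ im R) ip iq {z = z@(2 , _)} a b = stage-disjoint {p} {mid} i ip im {z = z} a b
  occupied-disjoint (cons i mid _ im R) ip iq {z = suc (suc (suc _)) , _} a b = occupied-disjoint R im iq a b

  top : ∀ {m p q} → Route unlabelled n v m p q → ℕ
  top (one _ _)          = 2
  top (cons _ _ _ _ R) = 3 + top R

  top-length : ∀ {m p q} (R : Route unlabelled n v m p q) → suc (top R) ≡ m * 3
  top-length (one _ _)          = refl
  top-length (cons _ _ _ _ R) = cong (3 +_) (top-length R)

  occupied-bounded : ∀ {m p q} (R : Route unlabelled n v m p q) {τ z} → Occupied R τ z → proj₁ z ≤ top R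
  occupied-bounded (one i _) {τ} {z} a = stage-bounded {τ = τ} {z} a
  occupied-bounded (cons i mid _ im R) {z = 0 , _} a = z≤n
  occupied-bounded (cons i mid _ im R) {z = 1 , _} a = s≤s z≤n
  occupied-bounded (cons i mid _ im R) {z = 2 , _} a = s≤s (s≤s z≤n)
  occupied-bounded (cons i mid _ im R) {z = suc (suc (suc _)) , _} a = s≤s (s≤s (s≤s (occupied-bounded R a)))

  occupied-entry : ∀ {m p q} (R : Route unlabelled n v m p q) τ h → Occupied R τ (0 , h , p τ)
  occupied-entry (one _ _)          τ h = refl
  occupied-entry (cons _ _ _ _ _) τ h = refl

  occupied-exit : ∀ {m p q} (R : Route unlabelled n v m p q) τ h → Occupied R τ (top R , h , q τ)
  occupied-exit (one _ _)          τ h = refl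
  occupied-exit (cons _ _ _ _ R) τ h = occupied-exit R τ h

  occupied-linked : ∀ {m p q} (R : Route unlabelled n v m p q) {τ z} → Occupied R τ z →
                    ∀ h → Star (Within E (Occupied R τ)) (0 , h , p τ) z
  occupied-linked (one i l) occ h = stage-linked l occ h
  occupied-linked R@(cons {p = p} i mid l im R′) {τ} {z} = go z
    where
    first : ∀ {z} → Stage p mid i τ z → ∀ h → Star (Within E (Occupied R τ)) (0 , h , p τ) z
    first {z} s h = gmap (λ z → z)
      (λ { {a} {b} (e , x , y) → e , stage⇒occupied {R = R′} {τ} {a} x , stage⇒occupied {R = R′} {τ} {b} y })
      (stage-linked l s h)
    go : ∀ z → Occupied R τ z → ∀ h → Star (Within E (Occupied R τ)) (0 , h , p τ) z
    go (0 , _) occ h = first {0 , _} occ h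
    go (1 , _) occ h = first {1 , _} occ h
    go (2 , _) occ h = first {2 , _} occ h
    go (suc (suc (suc ℓ)) , h′ , x) occ h =
      first {2 , h , mid τ} refl h
      ◅◅ ((up , refl , occupied-entry R′ τ h)
      ◅ gmap (λ { (ℓ , h , x) → 3 + ℓ , h , x }) shift (occupied-linked R′ occ h))
      where
      shift : ∀ {a b} → Within E (Occupied R′ τ) a b →
              Within E (Occupied R τ) (3 + proj₁ a , proj₂ a) (3 + proj₁ b , proj₂ b)
      shift (inH e , x , y) = inH e , x , y
      shift (inG e , x , y) = inG e , x , y
      shift (up    , x , y) = up , x , y
      shift (down  , x , y) = down , x , y

  network : ∀ {m p q} (R : Route unlabelled n v m p q) → JointInj unlabelled p → JointInj unlabelled q → Network H PG p q (top R)
  network R ip iq = record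
    { Occ = Occupied R ; occ? = occupied? R ; disjoint = occupied-disjoint R ip iq ; bounded = occupied-bounded R
    ; entry = occupied-entry R ; exit = occupied-exit R ; linked = occupied-linked R }

-- The added one is the slot layer: with N = n + 1 factors, 3 (2 N - 1) + 1 = 6 N - 2.
stages-layers : ∀ n → suc (stages n * 3) ≡ 6 * suc n ∸ 2
stages-layers zero    = refl
stages-layers (suc n) =
  trans (cong (6 +_) (stages-layers n))
        (trans (PE.sym (ℕP.+-∸-assoc 6 {6 * suc n} {2} (s≤s (ℕP.≤-trans (s≤s z≤n) (ℕP.m≤n+m _ n)))))
               (cong (_∸ 2) (PE.sym (ℕP.*-suc 6 (suc n)))))

route-network : ∀ {t k} n (v : Fin (suc n) → ℕ) (G : ∀ i → Graph (v i)) → (∀ i → Connected (G i)) → (∀ i → v i ≤ k) →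
                (H : Graph k) → Connected H → (p q : Fin t → Point (suc n) v) →
                (∀ {σ τ} → p σ ≡ p τ → σ ≡ τ) → (∀ {σ τ} → q σ ≡ q τ → σ ≡ τ) →
                ∃ λ top → Network H (prodGraph (suc n) v G) p q top × suc (suc top) ≡ 6 * suc n ∸ 2
route-network n v G conG v≤k H conH p q ip iq =
  top R , network R (λ _ → ip) (λ _ → iq) , trans (cong suc (top-length R)) (stages-layers n)
  where
  open Realise v G conG v≤k H conH
  R : Route unlabelled (suc n) v (stages n) p q
  R = beneš n v (λ { tt tt → yes refl }) unlabelled p q (λ _ → ip) (λ _ → iq)

-- Branch sets and minors

⇝-trans : ∀ {a b c} {G₁ : Graph a} {G₂ : Graph b} {G₃ : Graph c} → G₁ ⇝ G₂ → G₂ ⇝ G₃ → G₁ ⇝ G₃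
⇝-trans p done              = p
⇝-trans p (delVert q i)     = delVert (⇝-trans p q) i
⇝-trans p (delEdge q i j e) = delEdge (⇝-trans p q) i j e
⇝-trans p (contract q i j e) = contract (⇝-trans p q) i j e

-- Branch sets are kept as a decidable relation: deletion and contraction then merely precompose it
-- with `punchIn`, and the next vertex to delete or edge to contract can be found by search.
record Model {m n} (H : Graph m) (G : Graph n) : Set₁ where
  field
    Branch   : Fin n → Fin m → Set
    branch?  : ∀ x u → Dec (Branch x u)
    unique   : ∀ {x u w} → Branch x u → Branch x w → u ≡ w
    nonempty : ∀ u → ∃ λ x → Branch x u
    joined   : ∀ {u x y} → Branch x u → Branch y u → Star (Within (Adj G) (λ z → Branch z u)) x y
    edges    : ∀ {u w} → Adj H u w → ∃ λ x → ∃ λ y → Branch x u × Branch y w × Adj G x y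

-- The list drives the induction; for the list of all pairs, exactly the edges satisfying `Keep`
-- survive.
prune : ∀ {n} (G : Graph n) (Keep : Fin n → Fin n → Set) → (∀ a b → Dec (Keep a b)) → (∀ {a b} → Keep a b → Keep b a) →
        (ps : List (Fin n × Fin n)) →
        Σ (Graph n) λ G′ → (G ⇝ G′) ×
          (∀ {a b} → Keep a b → Adj G a b → Adj G′ a b) ×
          (∀ {a b} → (a , b) ∈ ps → Adj G′ a b → Keep a b)
prune G Keep keep? keep-sym [] = G , done , (λ _ e → e) , λ ()
prune G Keep keep? keep-sym ((i , j) ∷ ps) with prune G Keep keep? keep-sym ps
... | G′ , r , kept , only with adj? G′ i j | keep? i j
...   | no ¬e | _     = G′ , r , kept , λ { (here refl) e → ⊥-elim (¬e e) ; (there p) e → only p e }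
...   | yes _ | yes k = G′ , r , kept , λ { (here refl) _ → k ; (there p) e → only p e }
...   | yes e | no ¬k = deleteEdge G′ i j , delEdge r i j e ,
  (λ k a → kept k a , λ { (inj₁ (refl , refl)) → ¬k k ; (inj₂ (refl , refl)) → ¬k (keep-sym k) }) ,
  λ { (here refl) (_ , ne) → ⊥-elim (ne (inj₁ (refl , refl))) ; (there p) (a , _) → only p a }

spanning⇒minor : ∀ {m n} (H : Graph m) (G : Graph n) (f : Fin n → Fin m) (g : Fin m → Fin n) →
                 (∀ u → f (g u) ≡ u) → (∀ x → g (f x) ≡ x) → (∀ {u w} → Adj H u w → Adj G (g u) (g w)) → H ≼ G
spanning⇒minor {m} {n} H G f g fg gf hom
  with prune G (λ a b → Adj H (f a) (f b)) (λ a b → adj? H (f a) (f b)) (sym H) (cartesianProduct (allFin n) (allFin n))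
... | G′ , r , kept , only = n , G′ , r , mk↔ₛ′ g f gf fg , λ u w →
  (λ e → kept (subst₂ (Adj H) (PE.sym (fg u)) (PE.sym (fg w)) e) (hom e)) ,
  (λ e → subst₂ (Adj H) (fg u) (fg w) (only (∈-cartesianProduct⁺ (∈-allFin _) (∈-allFin _)) e))

module _ {m n : ℕ} {H : Graph m} {G : Graph (suc n)} (M : Model H G) where
  open Model M

  delete-unused : ∀ i → (∀ u → ¬ Branch i u) → Model H (deleteVertex G i)
  delete-unused i unused = record
    { Branch = λ x u → Branch (punchIn i x) u
    ; branch? = λ x u → branch? (punchIn i x) u
    ; unique = unique
    ; nonempty = λ u → let (x , b) = nonempty u in out b , subst (λ z → Branch z u) (PE.sym (out-≡ b)) b
    ; joined = λ b c → restrict (joined b c) refl refl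
    ; edges = λ e → let (x , y , b , c , a) = edges e in
        out b , out c , subst (λ z → Branch z _) (PE.sym (out-≡ b)) b , subst (λ z → Branch z _) (PE.sym (out-≡ c)) c ,
        subst₂ (Adj G) (PE.sym (out-≡ b)) (PE.sym (out-≡ c)) a
    }
    where
    used : ∀ {x u} → Branch x u → i ≢ x
    used b refl = unused _ b
    out : ∀ {x u} → Branch x u → Fin n
    out b = punchOut (used b)
    out-≡ : ∀ {x u} (b : Branch x u) → punchIn i (out b) ≡ x
    out-≡ b = FP.punchIn-punchOut (used b)
    restrict : ∀ {u x y a b} → Star (Within (Adj G) (λ z → Branch z u)) x y → punchIn i a ≡ x → punchIn i b ≡ y →
               Star (Within (Adj (deleteVertex G i)) (λ z → Branch (punchIn i z) u)) a b
    restrict {a = a} {b} ε p q with FP.punchIn-injective i a b (trans p (PE.sym q))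
    ... | refl = ε
    restrict ((e , c , d) ◅ s) refl q =
      (subst (Adj G _) (PE.sym (out-≡ d)) e , c , subst (λ z → Branch z _) (PE.sym (out-≡ d)) d) ◅ restrict s (out-≡ d) q

  -- The projection `to` moves `j` onto `i`, which lies in the same branch set. Joining paths are
  -- projected, and a step whose two ends become equal is dropped.
  contract-branch : ∀ i j (e : Adj G i j) {u} → Branch i u → Branch j u → Model H (contractEdge G i j e)
  contract-branch i j e {u} bi bj = record
    { Branch = λ x w → Branch (punchIn j x) w
    ; branch? = λ x w → branch? (punchIn j x) w
    ; unique = unique
    ; nonempty = λ w → let (x , b) = nonempty w in to x , to-branch b
    ; joined = λ b c → subst₂ (Star _) (to-punchIn _) (to-punchIn _) (path (joined b c))
    ; edges = λ h → let (x , y , b , c , a) = edges h in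
        to x , to y , to-branch b , to-branch c ,
        -- The ends cannot merge: they lie in branch sets of adjacent, hence distinct, vertices of
        -- `H`.
        to-adj a (λ eq → irr H (subst (Adj H _) (PE.sym (unique (to-branch b) (subst (λ z → Branch (punchIn j z) _) (PE.sym eq) (to-branch c)))) h))
    }
    where
    j≢i : j ≢ i
    j≢i refl = irr G e
    to : Fin (suc n) → Fin n
    to x with j FP.≟ x
    ... | yes _  = punchOut j≢i
    ... | no j≢x = punchOut j≢x
    to-spec : ∀ x → punchIn j (to x) ≡ x ⊎ (x ≡ j × punchIn j (to x) ≡ i)
    to-spec x with j FP.≟ x
    ... | yes p  = inj₂ (PE.sym p , FP.punchIn-punchOut j≢i)
    ... | no j≢x = inj₁ (FP.punchIn-punchOut j≢x)
    to-punchIn : ∀ a → to (punchIn j a) ≡ a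
    to-punchIn a with to-spec (punchIn j a)
    ... | inj₁ p       = FP.punchIn-injective j _ _ p
    ... | inj₂ (p , _) = ⊥-elim (FP.punchInᵢ≢i j a p)
    to-branch : ∀ {x w} → Branch x w → Branch (punchIn j (to x)) w
    to-branch {x} {w} b with to-spec x
    ... | inj₁ p = subst (λ z → Branch z w) (PE.sym p) b
    ... | inj₂ (refl , p) = subst₂ Branch (PE.sym p) (unique bj b) bi
    to-adj : ∀ {x y} → Adj G x y → to x ≢ to y → ContrAdj G i j (to x) (to y)
    to-adj {x} {y} a ne with to-spec x | to-spec y
    ... | inj₁ p | inj₁ q = ne , inj₁ (subst₂ (Adj G) (PE.sym p) (PE.sym q) a)
    ... | inj₂ (refl , p) | inj₁ q = ne , inj₂ (inj₁ (p , subst (Adj G _) (PE.sym q) a))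
    ... | inj₁ p | inj₂ (refl , q) = ne , inj₂ (inj₂ (q , subst (λ z → Adj G z j) (PE.sym p) a))
    ... | inj₂ (refl , p) | inj₂ (refl , q) = ⊥-elim (irr G a)
    path : ∀ {w x y} → Star (Within (Adj G) (λ z → Branch z w)) x y →
           Star (Within (ContrAdj G i j) (λ z → Branch (punchIn j z) w)) (to x) (to y)
    path ε = ε
    path {x = x} ((a , b , c) ◅ s) with to x FP.≟ to _
    ... | yes p = subst (λ z → Star _ z _) (PE.sym p) (path s)
    ... | no ne = (to-adj a ne , to-branch b , to-branch c) ◅ path s

-- Induction on the size of the host. A vertex outside all branch sets is deleted. If a branch set
-- has two vertices, the first step of a path joining them inside it is an edge to contract.
-- Otherwise the branch sets are singletons that exhaust the host, and only edges remain to be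
-- deleted.
model⇒minor : ∀ {m} n {H : Graph m} {G : Graph n} → Model H G → H ≼ G
model⇒minor n {H} {G} M with FP.all? (λ x → FP.any? (Model.branch? M x))
model⇒minor zero M | no ¬all = ⊥-elim (¬all λ ())
model⇒minor (suc n) M | no ¬all
  with FP.¬∀⟶∃¬ (suc n) _ (λ x → FP.any? (Model.branch? M x)) ¬all
... | i , unused with model⇒minor n (delete-unused M i (λ u b → unused (u , b)))
...   | k , G′ , r , iso = k , G′ , ⇝-trans (delVert done i) r , iso
model⇒minor n {H} {G} M | yes all
  with FP.any? (λ x → FP.any? λ y → ¬? (x FP.≟ y) ×-dec Model.branch? M y (proj₁ (all x)))
... | no inj = spanning⇒minor H G f g fg gf
                 (λ e → let (x , y , b , c , a) = Model.edges M e in subst₂ (Adj G) (branch-g b) (branch-g c) a)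
  where
  open Model M
  f = λ x → proj₁ (all x)
  g = λ u → proj₁ (nonempty u)
  fg : ∀ u → f (g u) ≡ u
  fg u = unique (proj₂ (all (g u))) (proj₂ (nonempty u))
  same : ∀ {x y} → Branch y (f x) → x ≡ y
  same {x} {y} b with x FP.≟ y
  ... | yes p = p
  ... | no ne = ⊥-elim (inj (x , y , ne , b))
  branch-g : ∀ {x u} → Branch x u → x ≡ g u
  branch-g {x} {u} b with unique (proj₂ (all x)) b
  ... | p = same (subst (Branch (g u)) (PE.sym p) (proj₂ (nonempty u)))
  gf : ∀ x → g (f x) ≡ x
  gf x = PE.sym (branch-g (proj₂ (all x)))
... | yes (x , y , ne , b) with Model.joined M (proj₂ (all x)) b
...   | ε = ⊥-elim (ne refl)
model⇒minor (suc n) {H} {G} M | yes all | yes (x , y , ne , b) | _◅_ {j = j} (a , bx , bj) _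
  with model⇒minor n (contract-branch M x j a bx bj)
... | k , G′ , r , iso = k , G′ , ⇝-trans (contract done x j a) r , iso

-- The universal host

concatFin : ∀ {A : Set} n → (Fin n → List A) → List A
concatFin zero    f = []
concatFin (suc n) f = f zero ++ concatFin n (λ i → f (suc i))

length-concatFin : ∀ {A : Set} n (f : Fin n → List A) (g : Fin n → ℕ) → (∀ i → length (f i) ≡ g i) →
                   length (concatFin n f) ≡ sumFin n g
length-concatFin zero    f g eq = refl
length-concatFin (suc n) f g eq = trans (length-++ (f zero)) (cong₂ _+_ (eq zero) (length-concatFin n _ _ (λ i → eq (suc i))))

∈-concatFin : ∀ {A : Set} n (f : Fin n → List A) {x} i → x ∈ f i → x ∈ concatFin n f
∈-concatFin (suc n) f zero    p = ∈-++⁺ˡ p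
∈-concatFin (suc n) f (suc i) p = ∈-++⁺ʳ (f zero) (∈-concatFin n _ i p)

module _ {n : ℕ} (H : Graph n) where

  edgeAt : Fin n → Fin n → List (Fin n × Fin n)
  edgeAt x y = if isYes ((x FP.<? y) ×-dec adj? H x y) then (x , y) ∷ [] else []

  edgeList : List (Fin n × Fin n)
  edgeList = concatFin n λ x → concatFin n λ y → edgeAt x y

  length-edgeList : length edgeList ≡ edgeCount H
  length-edgeList = length-concatFin n _ _ λ x → length-concatFin n _ _ λ y → length-edgeAt x y
    where
    length-edgeAt : ∀ x y → length (edgeAt x y) ≡ (if isYes ((x FP.<? y) ×-dec adj? H x y) then 1 else 0)
    length-edgeAt x y with (x FP.<? y) ×-dec adj? H x y
    ... | yes _ = refl
    ... | no _  = refl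

  ∈-edgeList : ∀ {x y} → x F.< y → Adj H x y → (x , y) ∈ edgeList
  ∈-edgeList {x} {y} x<y e = ∈-concatFin n _ x (∈-concatFin n _ y ∈-edgeAt)
    where
    ∈-edgeAt : (x , y) ∈ edgeAt x y
    ∈-edgeAt with (x FP.<? y) ×-dec adj? H x y
    ... | yes _ = here refl
    ... | no ¬e = ⊥-elim (¬e (x<y , e))

enumerateEdges : ∀ {n} (H : Graph n) → ∃ λ (ends : Fin (edgeCount H) → Fin n × Fin n) →
                 ∀ {x y} → Adj H x y → ∃ λ i → ends i ≡ (x , y) ⊎ ends i ≡ (y , x)
enumerateEdges H = subst (λ e → ∃ λ (ends : Fin e → _) → ∀ {x y} → Adj H x y → ∃ λ i → ends i ≡ (x , y) ⊎ ends i ≡ (y , x))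
                         (length-edgeList H) (lookupₗ (edgeList H) , locate)
  where
  locate : ∀ {x y} → Adj H x y → ∃ λ i → lookupₗ (edgeList H) i ≡ (x , y) ⊎ lookupₗ (edgeList H) i ≡ (y , x)
  locate {x} {y} e with FP.<-cmp x y
  ... | tri< x<y _ _ = let p = ∈-edgeList H x<y e in index p , inj₁ (PE.sym (lookup-index p))
  ... | tri≈ _ refl _ = ⊥-elim (irr H e)
  ... | tri> _ _ y<x = let p = ∈-edgeList H y<x (sym H e) in index p , inj₂ (PE.sym (lookup-index p))

least : ∀ {n} {P : Fin n → Set} → (∀ i → Dec (P i)) → (∃ λ i → P i × ∀ j → j F.< i → ¬ P j) ⊎ (∀ i → ¬ P i)
least {zero} P? = inj₂ λ ()
least {suc n} P? with P? zero
... | yes p = inj₁ (zero , p , λ _ ())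
... | no ¬p with least (λ i → P? (suc i))
...   | inj₂ none = inj₂ λ { zero → ¬p ; (suc i) → none i }
...   | inj₁ (i , p , min) = inj₁ (suc i , p , λ { zero _ → ¬p ; (suc j) (s≤s j<i) → min j j<i })

-- Chaining the slots of a vertex.

module Successor {D m : ℕ} (owner : Fin D → Fin m) where

  Later : Fin D → Fin D → Set
  Later s r = s F.< r × owner r ≡ owner s

  later? : ∀ s r → Dec (Later s r)
  later? s r = (s FP.<? r) ×-dec (owner r FP.≟ owner s)

  -- The last slot of every owner is sent to a dummy outside the slots, so that successor is total and injective.
  successor : Fin D → Fin (D + D)
  successor s with least (later? s)
  ... | inj₁ (r , _) = r ↑ˡ D
  ... | inj₂ _       = D ↑ʳ s

  -- Two slots with a common real successor have the same owner and both precede it, so the larger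
  -- would be an earlier successor of the smaller. Dummies are distinct by construction.
  successor-injective : ∀ {s t} → successor s ≡ successor t → s ≡ t
  successor-injective {s} {t} eq with least (later? s) | least (later? t)
  ... | inj₂ _ | inj₂ _ = FP.↑ʳ-injective D s t eq
  ... | inj₁ (r , _) | inj₂ _ with trans (PE.sym (FP.splitAt-↑ˡ D r D)) (trans (cong (splitAt D) eq) (FP.splitAt-↑ʳ D D t))
  ...   | ()
  successor-injective {s} {t} eq | inj₂ _ | inj₁ (r , _)
    with trans (PE.sym (FP.splitAt-↑ʳ D D s)) (trans (cong (splitAt D) eq) (FP.splitAt-↑ˡ D r D))
  ... | ()
  successor-injective {s} {t} eq | inj₁ (r , (s<r , os) , mins) | inj₁ (r′ , (t<r , ot) , mint)
    with FP.↑ˡ-injective D r r′ eq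
  ... | refl with FP.<-cmp s t
  ...   | tri≈ _ p _ = p
  ...   | tri< s<t _ _ = ⊥-elim (mins t t<r (s<t , trans (PE.sym ot) os))
  ...   | tri> _ _ t<s = ⊥-elim (mint s s<r (t<s , trans (PE.sym os) ot))

  module _ {u : Fin m} (_~_ : Fin D → Fin D → Set) (~-refl : ∀ {s} → s ~ s) (~-trans : ∀ {r s t} → r ~ s → s ~ t → r ~ t)
           (link : ∀ {s r} → owner s ≡ u → owner r ≡ u → successor s ≡ r ↑ˡ D → s ~ r) where

    -- The number `f` bounds the remaining distance. A successor step goes strictly upwards and
    -- cannot jump over `t`, which is itself a later slot of the same owner.
    chain : ∀ f {s t} → toℕ t ≤ toℕ s + f → s F.≤ t → owner s ≡ u → owner t ≡ u → s ~ t
    chain f {s} {t} bound s≤t os ot with s FP.≟ t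
    ... | yes refl = ~-refl
    ... | no s≢t with least (later? s) in eq
    ...   | inj₂ none = ⊥-elim (none t (FP.≤∧≢⇒< s≤t s≢t , trans ot (PE.sym os)))
    chain zero {s} {t} bound s≤t os ot | no s≢t | inj₁ _ =
      ⊥-elim (s≢t (FP.toℕ-injective (ℕP.≤-antisym s≤t (subst (toℕ t ≤_) (ℕP.+-identityʳ _) bound))))
    chain (suc f) {s} {t} bound s≤t os ot | no s≢t | inj₁ (r , (s<r , or) , min) =
      ~-trans (link os (trans or os) succ≡) (chain f bound′ r≤t (trans or os) ot)
      where
      succ≡ : successor s ≡ r ↑ˡ D
      succ≡ rewrite eq = refl
      r≤t : r F.≤ t
      r≤t = ℕP.≮⇒≥ λ t<r → min t t<r (FP.≤∧≢⇒< s≤t s≢t , trans ot (PE.sym os))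
      bound′ : toℕ t ≤ toℕ r + f
      bound′ = ℕP.≤-trans bound (subst (_≤ toℕ r + f) (PE.sym (ℕP.+-suc (toℕ s) f)) (ℕP.+-monoˡ-≤ f s<r))

module Coding {a b c d : ℕ} (A : Graph a) (B : Graph b) (C : Graph c) (D : Graph d) where

  Vertex : Set
  Vertex = Fin a × Fin b × Fin c × Fin d

  encode : Vertex → Fin (a * (b * (c * d)))
  encode (w , x , y , z) = combine w (combine x (combine y z))

  decode₃ : Fin (b * (c * d)) → Fin b × Fin c × Fin d
  decode₃ x = proj₁ (remQuot {b} (c * d) x) , remQuot {c} d (proj₂ (remQuot {b} (c * d) x))

  decode : Fin (a * (b * (c * d))) → Vertex
  decode x = proj₁ (remQuot {a} (b * (c * d)) x) , decode₃ (proj₂ (remQuot {a} (b * (c * d)) x))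

  decode-encode : ∀ x → decode (encode x) ≡ x
  decode-encode (w , x , y , z) =
    trans (cong (λ p → proj₁ p , decode₃ (proj₂ p)) (FP.remQuot-combine w (combine x (combine y z))))
          (cong (w ,_) (trans (cong (λ p → proj₁ p , remQuot {c} d (proj₂ p)) (FP.remQuot-combine x (combine y z)))
                              (cong (x ,_) (FP.remQuot-combine y z))))

  encode-decode : ∀ x → encode (decode x) ≡ x
  encode-decode x = trans (cong (combine (proj₁ x₄)) (trans (cong (combine (proj₁ x₃)) (FP.combine-remQuot {c} d (proj₂ x₃)))
                                                            (FP.combine-remQuot {b} (c * d) (proj₂ x₄))))
                          (FP.combine-remQuot {a} _ x)
    where
    x₄ = remQuot {a} (b * (c * d)) x
    x₃ = remQuot {b} (c * d) (proj₂ x₄)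

  data VAdj : Vertex → Vertex → Set where
    in₁ : ∀ {w w′ x y z} → Adj A w w′ → VAdj (w , x , y , z) (w′ , x , y , z)
    in₂ : ∀ {w x x′ y z} → Adj B x x′ → VAdj (w , x , y , z) (w , x′ , y , z)
    in₃ : ∀ {w x y y′ z} → Adj C y y′ → VAdj (w , x , y , z) (w , x , y′ , z)
    in₄ : ∀ {w x y z z′} → Adj D z z′ → VAdj (w , x , y , z) (w , x , y , z′)

  VAdj-sym : ∀ {v w} → VAdj v w → VAdj w v
  VAdj-sym (in₁ e) = in₁ (sym A e)
  VAdj-sym (in₂ e) = in₂ (sym B e)
  VAdj-sym (in₃ e) = in₃ (sym C e)
  VAdj-sym (in₄ e) = in₄ (sym D e)

  encode-adj : ∀ {v w} → VAdj v w → Adj (A □ (B □ (C □ D))) (encode v) (encode w)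
  encode-adj (in₁ e) = □-adjˡ A (B □ (C □ D)) _ _ _ e
  encode-adj (in₂ e) = □-adjʳ A (B □ (C □ D)) _ _ _ (□-adjˡ B (C □ D) _ _ _ e)
  encode-adj (in₃ e) = □-adjʳ A (B □ (C □ D)) _ _ _ (□-adjʳ B (C □ D) _ _ _ (□-adjˡ C D _ _ _ e))
  encode-adj (in₄ e) = □-adjʳ A (B □ (C □ D)) _ _ _ (□-adjʳ B (C □ D) _ _ _ (□-adjʳ C D _ _ _ e))

-- Excess layers are sent to the last one. This keeps `embed` total; it is faithful on the layers in
-- use by `bounded`.
clamp : ∀ {m} → ℕ → Fin (suc m)
clamp {zero}  _       = zero
clamp {suc m} zero    = zero
clamp {suc m} (suc ℓ) = suc (clamp ℓ)

toℕ-clamp : ∀ {m ℓ} → ℓ ≤ m → toℕ (clamp {m} ℓ) ≡ ℓ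
toℕ-clamp {zero}  z≤n       = refl
toℕ-clamp {suc m} z≤n       = refl
toℕ-clamp {suc m} (s≤s ℓ≤m) = cong suc (toℕ-clamp ℓ≤m)

module Assemble {k N m e : ℕ} (H₄ : Graph 4) (con₄ : Connected H₄) (Hₖ : Graph k) (conₖ : Connected Hₖ)
                (PG : Graph N) (H : Graph m) (noIso : NoIsolated H)
                (ends : Fin e → Fin m × Fin m)
                (complete : ∀ {x y} → Adj H x y → ∃ λ i → ends i ≡ (x , y) ⊎ ends i ≡ (y , x))
                (room : (e + e) + (e + e) ≤ N) where

  D : ℕ
  D = e + e

  owner : Fin D → Fin m
  owner s = [ (λ i → proj₁ (ends i)) , (λ i → proj₂ (ends i)) ]′ (splitAt e s)

  owner-fst : ∀ i → owner (i ↑ˡ e) ≡ proj₁ (ends i)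
  owner-fst i rewrite FP.splitAt-↑ˡ e i e = refl

  owner-snd : ∀ i → owner (e ↑ʳ i) ≡ proj₂ (ends i)
  owner-snd i rewrite FP.splitAt-↑ʳ e e i = refl

  open Successor owner public

  -- The first `D` points carry the slots and the next `D` the dummy targets of `successor`: four
  -- points per edge of `H`.
  place : Fin (D + D) → Fin N
  place s = inject≤ s room

  pos : Fin D → Fin N
  pos s = place (s ↑ˡ D)

  place-injective : ∀ {s t} → place s ≡ place t → s ≡ t
  place-injective = FP.inject≤-injective room room _ _

  pos-injective : ∀ {s t} → pos s ≡ pos t → s ≡ t
  pos-injective p = FP.↑ˡ-injective D _ _ (place-injective p)

  module _ {top : ℕ} (edgeNet : Network Hₖ PG (λ i → pos (i ↑ˡ e)) (λ i → pos (e ↑ʳ i)) top)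
           (succNet : Network Hₖ PG pos (λ s → place (successor s)) top) where

    open Coding H₄ (Cycle (2 + top)) Hₖ PG

    Host : Graph (4 * ((2 + top) * (k * N)))
    Host = H₄ □ (Cycle (2 + top) □ (Hₖ □ PG))

    module E = Network edgeNet
    module S = Network succNet

    -- The route of an edge belongs entirely to the owner of its first slot, so the edge of `H` is
    -- realised where the route arrives below the second slot. In the slot layer a slot extends over
    -- all of `H₄` and so connects the two copies that carry routes.
    InBranch : Fin m → Vertex → Set
    InBranch u (_           , zero  , h , x) = ∃ λ s → pos s ≡ x × owner s ≡ u
    InBranch u (zero        , suc ℓ , h , x) = ∃ λ i → E.Occ i (toℕ ℓ , h , x) × owner (i ↑ˡ e) ≡ u
    InBranch u (suc zero    , suc ℓ , h , x) = ∃ λ s → S.Occ s (toℕ ℓ , h , x) × owner s ≡ u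
    InBranch u (suc (suc _) , suc ℓ , h , x) = ⊥

    inBranch? : ∀ u z → Dec (InBranch u z)
    inBranch? u (_           , zero  , h , x) = FP.any? λ s → (pos s FP.≟ x) ×-dec (owner s FP.≟ u)
    inBranch? u (zero        , suc ℓ , h , x) = FP.any? λ i → E.occ? i _ ×-dec (owner (i ↑ˡ e) FP.≟ u)
    inBranch? u (suc zero    , suc ℓ , h , x) = FP.any? λ s → S.occ? s _ ×-dec (owner s FP.≟ u)
    inBranch? u (suc (suc _) , suc ℓ , h , x) = no λ ()

    inBranch-unique : ∀ z {u w} → InBranch u z → InBranch w z → u ≡ w
    inBranch-unique (_ , zero , h , x) (s , p , refl) (t , q , refl) = cong owner (pos-injective (trans p (PE.sym q)))
    inBranch-unique (zero , suc ℓ , h , x) (s , p , refl) (t , q , refl) = cong (λ i → owner (i ↑ˡ e)) (E.disjoint p q)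
    inBranch-unique (suc zero , suc ℓ , h , x) (s , p , refl) (t , q , refl) = cong owner (S.disjoint p q)

    Conn : Fin m → Vertex → Vertex → Set
    Conn u = Star (Within VAdj (InBranch u))

    Conn-sym : ∀ {u z w} → Conn u z w → Conn u w z
    Conn-sym = reverse λ { (e , p , q) → VAdj-sym e , q , p }

    h₀ : Fin k
    h₀ = fromℕ< (proj₁ conₖ)

    base : Fin D → Vertex
    base s = zero , zero , h₀ , pos s

    base-fibre : ∀ s {a h} → Conn (owner s) (base s) (a , zero , h , pos s)
    base-fibre s {a} {h} =
      walkMap (λ b → b , zero , h₀ , pos s) (λ e → in₁ e , (s , refl , refl) , (s , refl , refl)) (proj₂ con₄ zero a)
      ◅◅ walkMap (λ b → a , zero , b , pos s) (λ e → in₃ e , (s , refl , refl) , (s , refl , refl)) (proj₂ conₖ h₀ h)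

    embed : Fin 4 → Cell k N → Vertex
    embed a (ℓ , h , x) = a , suc (clamp ℓ) , h , x

    embed-toℕ : ∀ a (ℓ : Fin (suc top)) h x → embed a (toℕ ℓ , h , x) ≡ (a , suc ℓ , h , x)
    embed-toℕ a ℓ h x = cong (λ c → a , suc c , h , x) (FP.toℕ-injective (toℕ-clamp (ℕP.≤-pred (FP.toℕ<n ℓ))))

    consecutive : ∀ {ℓ} → suc ℓ ≤ top → Adj (Cycle (2 + top)) (suc (clamp ℓ)) (suc (clamp (suc ℓ)))
    consecutive {ℓ} le = (λ eq → ℕP.1+n≢n (trans (trans (PE.sym b) (cong toℕ (FP.suc-injective (PE.sym eq)))) a)) ,
                         inj₁ (inj₁ (cong suc (trans (cong suc a) (PE.sym b))))
      where
      a = toℕ-clamp {top} {ℓ} (ℕP.<⇒≤ le)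
      b = toℕ-clamp {top} {suc ℓ} le

    closing : Adj (Cycle (2 + top)) (suc (clamp top)) zero
    closing = (λ ()) , inj₁ (inj₂ (cong (λ ℓ → suc (suc ℓ)) (toℕ-clamp {top} ℕP.≤-refl) , refl))

    opening : Adj (Cycle (2 + top)) zero (suc (clamp 0))
    opening = (λ ()) , inj₁ (inj₁ (cong suc (PE.sym (toℕ-clamp {top} z≤n))))

    module Attach (a : Fin 4) {t : ℕ} (slot : Fin t → Fin D) {q} (net : Network Hₖ PG (λ τ → pos (slot τ)) q top)
                  (occ⇒branch : ∀ {τ z} → Network.Occ net τ z → InBranch (owner (slot τ)) (embed a z)) where
      open Network net

      attached : ∀ {τ z} → Occ τ z → Conn (owner (slot τ)) (base (slot τ)) (embed a z)
      attached {τ} {z} o = base-fibre (slot τ) {a} {h₀}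
        ◅◅ ((in₂ opening , (slot τ , refl , refl) , occ⇒branch (entry τ h₀)) ◅ gmap (embed a) embed-step (linked o h₀))
        where
        embed-step : ∀ {x y} → Within (LayerAdj Hₖ PG) (Occ τ) x y →
                     Within VAdj (InBranch (owner (slot τ))) (embed a x) (embed a y)
        embed-step (inH e , p , r) = in₃ e , occ⇒branch p , occ⇒branch r
        embed-step (inG e , p , r) = in₄ e , occ⇒branch p , occ⇒branch r
        embed-step (up   , p , r)  = in₂ (consecutive (bounded r)) , occ⇒branch p , occ⇒branch r
        embed-step (down , p , r)  = in₂ (sym (Cycle (2 + top)) (consecutive (bounded p))) , occ⇒branch p , occ⇒branch r

    edge-occ : ∀ {i z} → E.Occ i z → InBranch (owner (i ↑ˡ e)) (embed zero z)
    edge-occ {i} {_ , h , x} o = i , subst (λ ℓ → E.Occ i (ℓ , h , x)) (PE.sym (toℕ-clamp (E.bounded o))) o , refl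

    succ-occ : ∀ {s z} → S.Occ s z → InBranch (owner s) (embed (suc zero) z)
    succ-occ {s} {_ , h , x} o = s , subst (λ ℓ → S.Occ s (ℓ , h , x)) (PE.sym (toℕ-clamp (S.bounded o))) o , refl

    module AE = Attach zero (_↑ˡ e) edgeNet edge-occ
    module AS = Attach (suc zero) (λ s → s) succNet succ-occ

    to-base : ∀ {u} z → InBranch u z → ∃ λ s → owner s ≡ u × Conn u (base s) z
    to-base (a , zero , h , x) (s , refl , refl) = s , refl , base-fibre s
    to-base (zero , suc ℓ , h , x) (i , o , refl) =
      i ↑ˡ e , refl , subst (Conn _ _) (embed-toℕ zero ℓ h x) (AE.attached o)
    to-base (suc zero , suc ℓ , h , x) (s , o , refl) =
      s , refl , subst (Conn _ _) (embed-toℕ (suc zero) ℓ h x) (AS.attached o)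

    -- The route of `s` ends at the point `pos r` in the last layer, and the closing edge of the
    -- cycle leads from there into the fibre of slot `r`.
    successor-link : ∀ {u s r} → owner s ≡ u → owner r ≡ u → successor s ≡ r ↑ˡ D → Conn u (base s) (base r)
    successor-link {s = s} {r} refl or eq =
      AS.attached (S.exit s h₀)
      ◅◅ ((in₂ closing , succ-occ (S.exit s h₀) , (r , PE.sym (cong place eq) , or))
      ◅ subst (λ x → Conn _ (suc zero , zero , h₀ , x) (base r)) (PE.sym (cong place eq))
          (subst (λ u → Conn u (suc zero , zero , h₀ , pos r) (base r)) or (Conn-sym (base-fibre r))))

    joined-upwards : ∀ {u s t} → s F.≤ t → owner s ≡ u → owner t ≡ u → Conn u (base s) (base t)
    joined-upwards {u} {s} {t} = chain {u} (λ s t → Conn u (base s) (base t)) ε _◅◅_ successor-link (toℕ t) (ℕP.m≤n+m _ (toℕ s))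

    bases-joined : ∀ {u s t} → owner s ≡ u → owner t ≡ u → Conn u (base s) (base t)
    bases-joined {u} {s} {t} os ot with ℕP.≤-total (toℕ s) (toℕ t)
    ... | inj₁ s≤t = joined-upwards s≤t os ot
    ... | inj₂ t≤s = Conn-sym (joined-upwards t≤s ot os)

    branches-joined : ∀ {u} z w → InBranch u z → InBranch u w → Conn u z w
    branches-joined z w p q with to-base z p | to-base w q
    ... | s , os , c | t , ot , d = Conn-sym c ◅◅ (bases-joined os ot ◅◅ d)

    endpoint : ∀ u → ∃ λ s → owner s ≡ u
    endpoint u with complete (proj₂ (noIso u))
    ... | i , inj₁ p = i ↑ˡ e , trans (owner-fst i) (cong proj₁ p)
    ... | i , inj₂ p = e ↑ʳ i , trans (owner-snd i) (cong proj₂ p)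

    edge-realised : ∀ i {x y} → ends i ≡ (x , y) → ∃ λ z → ∃ λ w → InBranch x z × InBranch y w × VAdj z w
    edge-realised i {x} {y} p =
      embed zero (top , h₀ , pos (e ↑ʳ i)) , (zero , zero , h₀ , pos (e ↑ʳ i)) ,
      subst (λ u → InBranch u (embed zero (top , h₀ , pos (e ↑ʳ i)))) (trans (owner-fst i) (cong proj₁ p)) (edge-occ (E.exit i h₀)) ,
      (e ↑ʳ i , refl , trans (owner-snd i) (cong proj₂ p)) ,
      in₂ closing

    edge-witness : ∀ {x y} → Adj H x y → ∃ λ z → ∃ λ w → InBranch x z × InBranch y w × VAdj z w
    edge-witness a with complete a
    ... | i , inj₁ p = edge-realised i p
    ... | i , inj₂ p = let (z , w , b , c , e) = edge-realised i p in w , z , c , b , VAdj-sym e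

    encoded : ∀ {u} z → InBranch u z → InBranch u (decode (encode z))
    encoded {u} z = subst (InBranch u) (PE.sym (decode-encode z))

    model : Model H Host
    model = record
      { Branch = λ x u → InBranch u (decode x)
      ; branch? = λ x u → inBranch? u (decode x)
      ; unique = λ {x} → inBranch-unique (decode x)
      ; nonempty = λ u → let (s , os) = endpoint u in encode (base s) , encoded (base s) (s , refl , os)
      ; joined = λ {u} {x} {y} p q →
          subst₂ (Star (Within (Adj Host) (λ z → InBranch u (decode z)))) (encode-decode x) (encode-decode y)
            (gmap encode (λ { {z} {w} (e , b , c) → encode-adj e , encoded z b , encoded w c })
              (branches-joined (decode x) (decode y) p q))
      ; edges = λ a → let (z , w , b , c , e) = edge-witness a in
          encode z , encode w , encoded z b , encoded w c , encode-adj e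
      }

  minor : ∀ {c} → (∃ λ top → Network Hₖ PG (λ i → pos (i ↑ˡ e)) (λ i → pos (e ↑ʳ i)) top × suc (suc top) ≡ c) →
          (∃ λ top → Network Hₖ PG pos (λ s → place (successor s)) top × suc (suc top) ≡ c) →
          H ≼ (H₄ □ (Cycle c □ (Hₖ □ PG)))
  minor (_ , edgeNet , refl) (_ , succNet , refl) = model⇒minor _ (model edgeNet succNet)

lower-bound : (k n : ℕ) → 1 ≤ n → (v : Fin n → ℕ) → (G : (i : Fin n) → Graph (v i)) →
    (∀ i → v i ≤ k) → (∀ i → Connected (G i)) →
    (H₄ : Graph 4) → Connected H₄ → (Hₖ : Graph k) → Connected Hₖ →
    MinorUniversalFor (H₄ □ (Cycle (6 * n ∸ 2) □ (Hₖ □ prodGraph n v G)))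
    (λ e → 16 * e ≤ prodSize n v)
lower-bound k (suc n) _ v G v≤k conG H₄ con₄ Hₖ conₖ H noIso small =
  minor (route-network n v G conG v≤k Hₖ conₖ (λ i → pos (i ↑ˡ e)) (λ i → pos (e ↑ʳ i))
           (λ p → FP.↑ˡ-injective e _ _ (pos-injective p)) (λ p → FP.↑ʳ-injective e _ _ (pos-injective p)))
        (route-network n v G conG v≤k Hₖ conₖ pos (λ s → place (successor s))
           pos-injective (λ p → successor-injective (place-injective p)))
  where
  e : ℕ
  e = edgeCount H
  room : (e + e) + (e + e) ≤ prodSize (suc n) v
  room = ℕP.≤-trans (subst (_≤ 16 * e) (solve 1 (λ e → con 4 :* e := (e :+ e) :+ (e :+ e)) refl e)
                           (ℕP.*-monoˡ-≤ e (ℕP.m≤m+n 4 12))) small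
  open Assemble H₄ con₄ Hₖ conₖ (prodGraph (suc n) v G) H noIso (proj₁ (enumerateEdges H)) (proj₂ (enumerateEdges H)) room

-- Interval decompositions

ind : ∀ {P : Set} → Dec P → ℕ
ind (yes _) = 1
ind (no _)  = 0

ind-mono : ∀ {P Q : Set} (p : Dec P) (q : Dec Q) → (P → Q) → ind p ≤ ind q
ind-mono (no _)  q       f = z≤n
ind-mono (yes p) (yes _) f = ℕP.≤-refl
ind-mono (yes p) (no ¬q) f = ⊥-elim (¬q (f p))

ind-× : ∀ {P Q : Set} (p : Dec P) (q : Dec Q) → ind (p ×-dec q) ≡ ind p * ind q
ind-× (yes _) (yes _) = refl
ind-× (yes _) (no _)  = refl
ind-× (no _)  (yes _) = refl
ind-× (no _)  (no _)  = refl

ind-⊎ : ∀ {P Q R : Set} (p : Dec P) (q : Dec Q) (r : Dec R) → (P → Q ⊎ R) → ind p ≤ ind q + ind r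
ind-⊎ (no _)  q r f = z≤n
ind-⊎ (yes _) (yes _) r f = s≤s z≤n
ind-⊎ (yes p) (no ¬q) (yes _) f = ℕP.≤-refl
ind-⊎ (yes p) (no ¬q) (no ¬r) f with f p
... | inj₁ q = ⊥-elim (¬q q)
... | inj₂ r = ⊥-elim (¬r r)

sum-cong : ∀ n {f g : Fin n → ℕ} → (∀ i → f i ≡ g i) → sumFin n f ≡ sumFin n g
sum-cong zero    h = refl
sum-cong (suc n) h = cong₂ _+_ (h zero) (sum-cong n (λ i → h (suc i)))

sum-mono : ∀ n {f g : Fin n → ℕ} → (∀ i → f i ≤ g i) → sumFin n f ≤ sumFin n g
sum-mono zero    h = z≤n
sum-mono (suc n) h = ℕP.+-mono-≤ (h zero) (sum-mono n (λ i → h (suc i)))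

sum-+ : ∀ n (f g : Fin n → ℕ) → sumFin n (λ i → f i + g i) ≡ sumFin n f + sumFin n g
sum-+ zero    f g = refl
sum-+ (suc n) f g rewrite sum-+ n (λ i → f (suc i)) (λ i → g (suc i)) =
  solve 4 (λ a b c d → (a :+ b) :+ (c :+ d) := (a :+ c) :+ (b :+ d)) refl (f zero) (g zero) _ _

sum-* : ∀ n c (f : Fin n → ℕ) → sumFin n (λ i → c * f i) ≡ c * sumFin n f
sum-* zero    c f = PE.sym (ℕP.*-zeroʳ c)
sum-* (suc n) c f rewrite sum-* n c (λ i → f (suc i)) = PE.sym (ℕP.*-distribˡ-+ c (f zero) _)

sum-const : ∀ n c → sumFin n (λ _ → c) ≡ n * c
sum-const zero    c = refl
sum-const (suc n) c = cong (c +_) (sum-const n c)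

sum-swap : ∀ m n (f : Fin m → Fin n → ℕ) →
           sumFin m (λ x → sumFin n (f x)) ≡ sumFin n (λ y → sumFin m (λ x → f x y))
sum-swap zero    n f = PE.sym (trans (sum-const n 0) (ℕP.*-zeroʳ n))
sum-swap (suc m) n f = trans (cong (sumFin n (f zero) +_) (sum-swap m n (λ x → f (suc x))))
                             (PE.sym (sum-+ n (f zero) _))

sum-product : ∀ m n (f : Fin m → ℕ) (g : Fin n → ℕ) →
              sumFin m (λ x → sumFin n (λ y → f x * g y)) ≡ sumFin m f * sumFin n g
sum-product m n f g = trans (sum-cong m (λ x → trans (sum-* n (f x) g) (ℕP.*-comm (f x) _)))
                            (trans (sum-* m (sumFin n g) f) (ℕP.*-comm (sumFin n g) _))

sum-split : ∀ m n (f : Fin (m + n) → ℕ) → sumFin (m + n) f ≡ sumFin m (λ i → f (i ↑ˡ n)) + sumFin n (λ i → f (m ↑ʳ i))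
sum-split zero    n f = refl
sum-split (suc m) n f = trans (cong (f zero +_) (sum-split m n (λ i → f (suc i)))) (PE.sym (ℕP.+-assoc (f zero) _ _))

sum-combine : ∀ m n (f : Fin (m * n) → ℕ) → sumFin (m * n) f ≡ sumFin m (λ a → sumFin n (λ b → f (combine a b)))
sum-combine zero    n f = refl
sum-combine (suc m) n f = trans (sum-split n (m * n) f) (cong (sumFin n (λ i → f (i ↑ˡ (m * n))) +_) (sum-combine m n _))

sum-punchIn : ∀ n (f : Fin (suc n) → ℕ) j → sumFin (suc n) f ≡ f j + sumFin n (λ i → f (punchIn j i))
sum-punchIn n       f zero    = refl
sum-punchIn (suc n) f (suc j) = trans (cong (f zero +_) (sum-punchIn n (λ i → f (suc i)) j))
  (solve 3 (λ a b c → a :+ (b :+ c) := b :+ (a :+ c)) refl (f zero) (f (suc j)) (sumFin n (λ i → f (suc (punchIn j i)))))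

term≤sum : ∀ n (f : Fin n → ℕ) j → f j ≤ sumFin n f
term≤sum (suc n) f zero    = ℕP.m≤m+n _ _
term≤sum (suc n) f (suc j) = ℕP.≤-trans (term≤sum n (λ i → f (suc i)) j) (ℕP.m≤n+m _ (f zero))

sum-injective : ∀ m n (f : Fin n → ℕ) (g : Fin m → Fin n) → (∀ {x y} → g x ≡ g y → x ≡ y) →
                sumFin m (λ x → f (g x)) ≤ sumFin n f
sum-injective zero    n       f g inj = z≤n
sum-injective (suc m) zero    f g inj with g zero
... | ()
sum-injective (suc m) (suc n) f g inj =
  subst (f (g zero) + sumFin m (λ x → f (g (suc x))) ≤_) (PE.sym (sum-punchIn n f (g zero)))
    (ℕP.+-monoʳ-≤ (f (g zero))
      (subst (_≤ sumFin n (λ i → f (punchIn (g zero) i)))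
        (sum-cong m (λ x → cong f (FP.punchIn-punchOut (ne x))))
        (sum-injective m n (λ i → f (punchIn (g zero) i)) (λ x → punchOut (ne x))
          (λ {x} {y} eq → FP.suc-injective (inj (FP.punchOut-injective (ne x) (ne y) eq))))))
  where
  ne : ∀ x → g zero ≢ g (suc x)
  ne x eq with inj eq
  ... | ()

sum-unique : ∀ n {P : Fin n → Set} (P? : ∀ i → Dec (P i)) → (∀ {x y} → P x → P y → x ≡ y) → sumFin n (λ i → ind (P? i)) ≤ 1
sum-unique zero    P? uniq = z≤n
sum-unique (suc n) P? uniq with P? zero
... | no _  = sum-unique n (λ i → P? (suc i)) (λ p q → FP.suc-injective (uniq p q))
... | yes p = s≤s (ℕP.≤-reflexive (trans (sum-cong n none) (trans (sum-const n 0) (ℕP.*-zeroʳ n))))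
  where
  none : ∀ i → ind (P? (suc i)) ≡ 0
  none i with P? (suc i)
  ... | no _  = refl
  ... | yes q with uniq p q
  ...   | ()

Between : ℕ → ℕ → ℕ → Set
Between a b t = a ≤ t × t ≤ b

between? : ∀ a b t → Dec (Between a b t)
between? a b t = (a ≤? t) ×-dec (t ≤? b)

-- An interval model of path decompositions: t ranges over the bags, and the vertex x occurs in the bags lo x, …, hi x.
-- Adjacent vertices share a bag or occur in two consecutive bags.
record Layered {n} (G : Graph n) (w : ℕ) : Set where
  field
    lo hi : Fin n → ℕ
    lo≤hi : ∀ x → lo x ≤ hi x
    close : ∀ {x y} → Adj G x y → lo x ≤ suc (hi y)
    thin  : ∀ t → sumFin n (λ x → ind (between? (lo x) (hi x) t)) ≤ w

layered-delVert : ∀ {n w} {G : Graph (suc n)} → Layered G w → ∀ i → Layered (deleteVertex G i) w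
layered-delVert {n} L i = record
  { lo = λ x → lo (punchIn i x) ; hi = λ x → hi (punchIn i x) ; lo≤hi = λ x → lo≤hi (punchIn i x) ; close = close
  ; thin = λ t → ℕP.≤-trans (sum-injective n (suc n) (λ x → ind (between? (lo x) (hi x) t)) (punchIn i) (FP.punchIn-injective i _ _)) (thin t) }
  where open Layered L

layered-delEdge : ∀ {n w} {G : Graph n} → Layered G w → ∀ i j → Layered (deleteEdge G i j) w
layered-delEdge L i j = record { lo = lo ; hi = hi ; lo≤hi = lo≤hi ; close = λ e → close (proj₁ e) ; thin = thin }
  where open Layered L

hull : ∀ {a b c d t} → a ≤ suc d → c ≤ suc b → Between (a ⊓ c) (b ⊔ d) t → Between a b t ⊎ Between c d t
hull {a} {b} {c} {d} {t} a≤d c≤b (p , q) with a ≤? t | t ≤? b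
... | yes a≤t | yes t≤b = inj₁ (a≤t , t≤b)
... | no a≰t | _ = inj₂ (c≤t , ℕP.≤-pred (ℕP.≤-trans (ℕP.≰⇒> a≰t) a≤d))
  where
  c≤t : c ≤ t
  c≤t with ℕP.⊓-sel a c
  ... | inj₁ e = ⊥-elim (a≰t (subst (_≤ t) e p))
  ... | inj₂ e = subst (_≤ t) e p
... | yes _ | no t≰b = inj₂ (ℕP.≤-trans c≤b (ℕP.≰⇒> t≰b) , t≤d)
  where
  t≤d : t ≤ d
  t≤d with ℕP.⊔-sel b d
  ... | inj₁ e = ⊥-elim (t≰b (subst (t ≤_) e q))
  ... | inj₂ e = subst (t ≤_) e q

layered-contract : ∀ {n w} {G : Graph (suc n)} → Layered G w → ∀ i j (e : Adj G i j) → Layered (contractEdge G i j e) w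
layered-contract {n} {w} {G} L i j e = record
  { lo = lo′ ; hi = hi′
  ; lo≤hi = λ x → ℕP.≤-trans (lo-old x) (ℕP.≤-trans (lo≤hi (punchIn j x)) (hi-old x))
  ; close = close′ ; thin = thin′ }
  where
  open Layered L
  -- The merged vertex gets the hull of both intervals, which is their union because they touch.
  lo′ hi′ : Fin n → ℕ
  lo′ x with punchIn j x FP.≟ i
  ... | yes _ = lo i ⊓ lo j
  ... | no _  = lo (punchIn j x)
  hi′ x with punchIn j x FP.≟ i
  ... | yes _ = hi i ⊔ hi j
  ... | no _  = hi (punchIn j x)
  lo-old : ∀ x → lo′ x ≤ lo (punchIn j x)
  lo-old x with punchIn j x FP.≟ i
  ... | yes p = subst (λ y → lo i ⊓ lo j ≤ lo y) (PE.sym p) (ℕP.m⊓n≤m (lo i) (lo j))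
  ... | no _  = ℕP.≤-refl
  hi-old : ∀ x → hi (punchIn j x) ≤ hi′ x
  hi-old x with punchIn j x FP.≟ i
  ... | yes p = subst (λ y → hi y ≤ hi i ⊔ hi j) (PE.sym p) (ℕP.m≤m⊔n (hi i) (hi j))
  ... | no _  = ℕP.≤-refl
  lo-merged : ∀ x → punchIn j x ≡ i → lo′ x ≤ lo j
  lo-merged x p with punchIn j x FP.≟ i
  ... | yes _ = ℕP.m⊓n≤n (lo i) (lo j)
  ... | no ¬p = ⊥-elim (¬p p)
  hi-merged : ∀ x → punchIn j x ≡ i → hi j ≤ hi′ x
  hi-merged x p with punchIn j x FP.≟ i
  ... | yes _ = ℕP.m≤n⊔m (hi i) (hi j)
  ... | no ¬p = ⊥-elim (¬p p)
  close′ : ∀ {a b} → ContrAdj G i j a b → lo′ a ≤ suc (hi′ b)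
  close′ {a} {b} (_ , inj₁ f) = ℕP.≤-trans (lo-old a) (ℕP.≤-trans (close f) (s≤s (hi-old b)))
  close′ {a} {b} (_ , inj₂ (inj₁ (p , f))) = ℕP.≤-trans (lo-merged a p) (ℕP.≤-trans (close f) (s≤s (hi-old b)))
  close′ {a} {b} (_ , inj₂ (inj₂ (p , f))) = ℕP.≤-trans (lo-old a) (ℕP.≤-trans (close f) (s≤s (hi-merged b p)))
  module _ (t : ℕ) where
    old : Fin (suc n) → ℕ
    old x = ind (between? (lo x) (hi x) t)
    -- Vertex `j` is gone from the new sum, so its old contribution is charged to the merged vertex;
    -- the indicator of `i` ensures that it is charged at most once.
    pointwise : ∀ x → ind (between? (lo′ x) (hi′ x) t) ≤ old (punchIn j x) + old j * ind (punchIn j x FP.≟ i)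
    pointwise x with punchIn j x FP.≟ i
    ... | no _  = ℕP.m≤m+n _ _
    ... | yes p rewrite p | ℕP.*-identityʳ (old j) =
      ind-⊎ (between? (lo i ⊓ lo j) (hi i ⊔ hi j) t) (between? (lo i) (hi i) t) (between? (lo j) (hi j) t)
        (hull (close e) (close (sym G e)))
    thin′ : sumFin n (λ x → ind (between? (lo′ x) (hi′ x) t)) ≤ w
    thin′ = begin
      sumFin n (λ x → ind (between? (lo′ x) (hi′ x) t))                              ≤⟨ sum-mono n pointwise ⟩
      sumFin n (λ x → old (punchIn j x) + old j * ind (punchIn j x FP.≟ i))          ≡⟨ sum-+ n _ _ ⟩
      O + sumFin n (λ x → old j * ind (punchIn j x FP.≟ i))                          ≡⟨ cong (O +_) (sum-* n (old j) _) ⟩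
      O + old j * sumFin n (λ x → ind (punchIn j x FP.≟ i))                          ≤⟨ ℕP.+-monoʳ-≤ O (ℕP.*-monoʳ-≤ (old j)
                                                                                         (sum-unique n (λ x → punchIn j x FP.≟ i) (λ p q → FP.punchIn-injective j _ _ (trans p (PE.sym q))))) ⟩
      O + old j * 1                                                                  ≡⟨ cong (O +_) (ℕP.*-identityʳ (old j)) ⟩
      O + old j                                                                      ≡⟨ ℕP.+-comm O (old j) ⟩
      old j + O                                                                      ≡⟨ sum-punchIn n old j ⟨
      sumFin (suc n) old                                                             ≤⟨ thin t ⟩
      w ∎
      where
      open ℕP.≤-Reasoning
      O : ℕ
      O = sumFin n (λ x → old (punchIn j x))

layered-⇝ : ∀ {m n w} {G : Graph m} {G′ : Graph n} → Layered G w → G ⇝ G′ → Layered G′ w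
layered-⇝ L done              = L
layered-⇝ L (delVert r i)     = layered-delVert (layered-⇝ L r) i
layered-⇝ L (delEdge r i j _) = layered-delEdge (layered-⇝ L r) i j
layered-⇝ L (contract r i j e) = layered-contract (layered-⇝ L r) i j e

layered-≼ : ∀ {m n w} {H : Graph m} {G : Graph n} → Layered G w → H ≼ G → Layered H w
layered-≼ {m} L (k , G′ , r , f , hom) = record
  { lo = λ x → lo (to x) ; hi = λ x → hi (to x) ; lo≤hi = λ x → lo≤hi (to x) ; close = λ {x} {y} e → close (proj₁ (hom x y) e)
  ; thin = λ t → ℕP.≤-trans (sum-injective m k (λ x → ind (between? (lo x) (hi x) t)) to
      (λ {x} {y} eq → trans (PE.sym (Inverse.strictlyInverseʳ f x)) (trans (cong from eq) (Inverse.strictlyInverseʳ f y)))) (thin t) }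
  where
  open Layered (layered-⇝ L r)
  open Inverse f using (to; from)

-- Layer sizes

-- paths a b is the binomial coefficient (a + b) choose a.
paths : ℕ → ℕ → ℕ
paths zero    b       = 1
paths (suc a) zero    = 1
paths (suc a) (suc b) = paths a (suc b) + paths (suc a) b

paths-zeroʳ : ∀ a → paths a 0 ≡ 1
paths-zeroʳ zero    = refl
paths-zeroʳ (suc a) = refl

paths-comm : ∀ a b → paths a b ≡ paths b a
paths-comm zero    b       = PE.sym (paths-zeroʳ b)
paths-comm (suc a) zero    = refl
paths-comm (suc a) (suc b) = trans (cong₂ _+_ (paths-comm a (suc b)) (paths-comm (suc a) b)) (ℕP.+-comm (paths (suc b) a) _)

-- The absorption identity of binomial coefficients and its mirror image. Pascal's rule produces one
-- term of each kind, hence the mutual recursion.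
absorbˡ : ∀ a b → suc a * paths (suc a) b ≡ suc (a + b) * paths a b
absorbʳ : ∀ a b → suc b * paths a (suc b) ≡ suc (a + b) * paths a b
absorbˡ a zero rewrite paths-zeroʳ a | ℕP.+-identityʳ a = refl
absorbˡ a (suc b) = begin
  suc a * (paths a (suc b) + paths (suc a) b)              ≡⟨ ℕP.*-distribˡ-+ (suc a) (paths a (suc b)) _ ⟩
  suc a * paths a (suc b) + suc a * paths (suc a) b        ≡⟨ cong (suc a * paths a (suc b) +_) (trans (absorbˡ a b) (PE.sym (absorbʳ a b))) ⟩
  suc a * paths a (suc b) + suc b * paths a (suc b)        ≡⟨ solve 3 (λ a b p → (con 1 :+ a) :* p :+ (con 1 :+ b) :* p := (con 1 :+ (a :+ (con 1 :+ b))) :* p) refl a b (paths a (suc b)) ⟩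
  suc (a + suc b) * paths a (suc b)                        ∎
  where open PE.≡-Reasoning
absorbʳ zero    b = refl
absorbʳ (suc a) b = begin
  suc b * (paths a (suc b) + paths (suc a) b)              ≡⟨ ℕP.*-distribˡ-+ (suc b) (paths a (suc b)) _ ⟩
  suc b * paths a (suc b) + suc b * paths (suc a) b        ≡⟨ cong (_+ suc b * paths (suc a) b) (trans (absorbʳ a b) (PE.sym (absorbˡ a b))) ⟩
  suc a * paths (suc a) b + suc b * paths (suc a) b        ≡⟨ solve 3 (λ a b p → (con 1 :+ a) :* p :+ (con 1 :+ b) :* p := (con 1 :+ ((con 1 :+ a) :+ b)) :* p) refl a b (paths (suc a) b) ⟩
  suc (suc a + b) * paths (suc a) b                        ∎
  where open PE.≡-Reasoning

-- By absorption the two neighbours in a row of Pascal's triangle are in the ratio (a + 1) : (b +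
-- 1), so the row increases up to its middle.
paths-step : ∀ a b → a ≤ b → paths a (suc b) ≤ paths (suc a) b
paths-step a b a≤b = ℕP.*-cancelˡ-≤ (suc a) (begin
  suc a * paths a (suc b)  ≤⟨ ℕP.*-monoˡ-≤ (paths a (suc b)) (s≤s a≤b) ⟩
  suc b * paths a (suc b)  ≡⟨ trans (absorbʳ a b) (PE.sym (absorbˡ a b)) ⟩
  suc a * paths (suc a) b  ∎)
  where open ℕP.≤-Reasoning

paths≤central : ∀ d a → paths a (a + (d + d)) ≤ paths (d + a) (d + a)
paths≤central zero    a rewrite ℕP.+-identityʳ a = ℕP.≤-refl
paths≤central (suc d) a = begin
  paths a (a + (suc d + suc d))             ≡⟨ cong (paths a) (solve 2 (λ a d → a :+ ((con 1 :+ d) :+ (con 1 :+ d)) := con 1 :+ (con 1 :+ a :+ (d :+ d))) refl a d) ⟩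
  paths a (suc (suc a + (d + d)))           ≤⟨ paths-step a (suc a + (d + d)) (ℕP.≤-trans (ℕP.n≤1+n a) (ℕP.m≤m+n (suc a) _)) ⟩
  paths (suc a) (suc a + (d + d))           ≤⟨ paths≤central d (suc a) ⟩
  paths (d + suc a) (d + suc a)             ≡⟨ cong (λ x → paths x x) (ℕP.+-suc d a) ⟩
  paths (suc d + a) (suc d + a)             ∎
  where open ℕP.≤-Reasoning

paths≤middle-ordered : ∀ m a b → a ≤ b → a + b ≡ m + m → paths a b ≤ paths m m
paths≤middle-ordered m a b a≤b eq = subst₂ (λ b m → paths a b ≤ paths m m) b≡ (ℕP.m∸n+n≡m a≤m) (paths≤central (m ∸ a) a)
  where
  a≤m : a ≤ m
  a≤m = ℕP.≮⇒≥ λ m<a → ℕP.<⇒≱ (ℕP.+-mono-< m<a m<a) (ℕP.≤-trans (ℕP.+-monoʳ-≤ a a≤b) (ℕP.≤-reflexive eq))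
  b≡ : a + (m ∸ a + (m ∸ a)) ≡ b
  b≡ = ℕP.+-cancelˡ-≡ a _ _ (trans
    (solve 2 (λ a d → a :+ (a :+ (d :+ d)) := (d :+ a) :+ (d :+ a)) refl a (m ∸ a))
    (trans (cong (λ x → x + x) (ℕP.m∸n+n≡m a≤m)) (PE.sym eq)))

paths≤middle : ∀ m a b → a + b ≡ m + m → paths a b ≤ paths m m
paths≤middle m a b eq with ℕP.≤-total a b
... | inj₁ a≤b = paths≤middle-ordered m a b a≤b eq
... | inj₂ b≤a = subst (_≤ paths m m) (paths-comm b a) (paths≤middle-ordered m b a b≤a (trans (ℕP.+-comm b a) eq))

central-step : ∀ m → suc m * paths (suc m) (suc m) ≡ 2 * (suc (m + m) * paths m m)
central-step m = begin
  suc m * paths (suc m) (suc m)           ≡⟨ absorbʳ (suc m) m ⟩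
  suc (suc m + m) * paths (suc m) m       ≡⟨ solve 2 (λ m p → (con 1 :+ (con 1 :+ m :+ m)) :* p := con 2 :* ((con 1 :+ m) :* p)) refl m (paths (suc m) m) ⟩
  2 * (suc m * paths (suc m) m)           ≡⟨ cong (2 *_) (absorbˡ m m) ⟩
  2 * (suc (m + m) * paths m m)           ∎
  where open PE.≡-Reasoning

-- The squared form of the bound 4ᵐ / √(2m + 1) on the central coefficient. The induction step comes
-- down to (2m + 1) (2m + 3) = (2m + 2)² - 1.
central-bound : ∀ m → paths m m * paths m m * suc (m + m) ≤ 16 ^ m
central-bound zero    = ℕP.≤-refl
central-bound (suc m) = ℕP.*-cancelˡ-≤ (suc m * suc m) (begin
  suc m * suc m * (X * X * suc (suc m + suc m))
    ≡⟨ solve 2 (λ m x → (con 1 :+ m) :* (con 1 :+ m) :* (x :* x :* (con 1 :+ (con 1 :+ m :+ (con 1 :+ m))))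
                     := ((con 1 :+ m) :* x) :* ((con 1 :+ m) :* x) :* (con 3 :+ (m :+ m))) refl m X ⟩
  (suc m * X) * (suc m * X) * (3 + (m + m))
    ≡⟨ cong (λ y → y * y * (3 + (m + m))) (central-step m) ⟩
  (2 * (suc (m + m) * Y)) * (2 * (suc (m + m) * Y)) * (3 + (m + m))
    ≡⟨ solve 2 (λ m y → (con 2 :* ((con 1 :+ (m :+ m)) :* y)) :* (con 2 :* ((con 1 :+ (m :+ m)) :* y)) :* (con 3 :+ (m :+ m))
                     := (con 4 :* ((con 1 :+ (m :+ m)) :* (con 3 :+ (m :+ m)))) :* (y :* y :* (con 1 :+ (m :+ m)))) refl m Y ⟩
  (4 * (suc (m + m) * (3 + (m + m)))) * (Y * Y * suc (m + m))
    ≤⟨ ℕP.*-mono-≤ coefficient (central-bound m) ⟩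
  (suc m * suc m * 16) * 16 ^ m
    ≡⟨ ℕP.*-assoc (suc m * suc m) 16 (16 ^ m) ⟩
  suc m * suc m * (16 * 16 ^ m) ∎)
  where
  open ℕP.≤-Reasoning
  X = paths (suc m) (suc m)
  Y = paths m m
  coefficient : 4 * (suc (m + m) * (3 + (m + m))) ≤ suc m * suc m * 16
  coefficient = begin
    4 * (suc (m + m) * (3 + (m + m)))      ≤⟨ ℕP.m≤m+n _ 4 ⟩
    4 * (suc (m + m) * (3 + (m + m))) + 4  ≡⟨ solve 1 (λ m → con 4 :* ((con 1 :+ (m :+ m)) :* (con 3 :+ (m :+ m))) :+ con 4
                                                         := (con 1 :+ m) :* (con 1 :+ m) :* con 16) refl m ⟩
    suc m * suc m * 16                     ∎

-- The weight distribution as a mixture of fair coins.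

shift : (ℕ → ℕ) → ℕ → ℕ
shift f zero    = 0
shift f (suc j) = f j

-- layer c n t j is the coefficient of zʲ in (1 + z + c z)ⁿ (1 + z)ᵗ. Each of the n coordinates with c + 2 values
-- is split into a fair coin (the values 0 and 1) and c values of weight one, so that the fair coins can be collected.
layer : ℕ → ℕ → ℕ → ℕ → ℕ
layer c zero    zero    zero    = 1
layer c zero    zero    (suc j) = 0
layer c zero    (suc t) j       = layer c zero t j + shift (layer c zero t) j
layer c (suc n) t       j       = layer c n (suc t) j + c * shift (layer c n t) j

layer-coin : ∀ c n t j → layer c n (suc t) j ≡ layer c n t j + shift (layer c n t) j
layer-coin c zero    t j = refl
layer-coin c (suc n) t zero    rewrite layer-coin c n (suc t) zero | ℕP.*-zeroʳ c | ℕP.+-identityʳ (layer c n (suc t) zero + 0) = refl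
layer-coin c (suc n) t (suc j) rewrite layer-coin c n (suc t) (suc j) | layer-coin c n t j =
  solve 5 (λ a b c p q → (a :+ b) :+ c :* (p :+ q) := (a :+ c :* p) :+ (b :+ c :* q)) refl
    (layer c n (suc t) (suc j)) (layer c n t j + shift (layer c n t) j) c (layer c n t j) (shift (layer c n t) j)

-- Undoing the split gives 1 + z + c z = 1 + (c + 1) z, one zero value against c + 1 nonzero ones.
-- This is the recursion that the weights of points satisfy.
layer-suc : ∀ c n j → layer c (suc n) 0 j ≡ layer c n 0 j + suc c * shift (layer c n 0) j
layer-suc c n j rewrite layer-coin c n 0 j =
  ℕP.+-assoc (layer c n 0 j) (shift (layer c n 0) j) _

layer-zero : ∀ c n t → layer c n t 0 ≡ 1
layer-zero c zero    zero    = refl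
layer-zero c zero    (suc t) rewrite layer-zero c zero t = refl
layer-zero c (suc n) t rewrite layer-zero c n (suc t) | ℕP.*-zeroʳ c = refl

binomial-vanish : ∀ c t j → t < j → layer c 0 t j ≡ 0
binomial-vanish c zero    (suc j) _ = refl
binomial-vanish c (suc t) (suc j) (s≤s t<j)
  rewrite binomial-vanish c t (suc j) (ℕP.m<n⇒m<1+n t<j) | binomial-vanish c t j t<j = refl

binomial-paths : ∀ c a b → layer c 0 (a + b) a ≡ paths a b
binomial-paths c zero b = layer-zero c 0 b
binomial-paths c (suc a) zero rewrite binomial-vanish c (a + 0) (suc a) (s≤s (ℕP.≤-reflexive (ℕP.+-identityʳ a))) =
  trans (binomial-paths c a 0) (paths-zeroʳ a)
binomial-paths c (suc a) (suc b) = trans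
  (cong₂ _+_ (trans (cong (λ t → layer c 0 t (suc a)) (ℕP.+-suc a b)) (binomial-paths c (suc a) b)) (binomial-paths c a (suc b)))
  (ℕP.+-comm (paths (suc a) b) _)

binomial≤middle : ∀ c m j → layer c 0 (m + m) j ≤ paths m m
binomial≤middle c m j with j ≤? m + m
... | yes j≤ = subst (_≤ paths m m)
                 (trans (PE.sym (binomial-paths c j (m + m ∸ j))) (cong (λ t → layer c 0 t j) (ℕP.m+[n∸m]≡n j≤)))
                 (paths≤middle m j (m + m ∸ j) (ℕP.m+[n∸m]≡n j≤))
... | no j≰  = subst (_≤ paths m m) (PE.sym (binomial-vanish c (m + m) j (ℕP.≰⇒> j≰))) z≤n

shift≤ : ∀ {b} (f : ℕ → ℕ) → (∀ j → f j ≤ b) → ∀ j → shift f j ≤ b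
shift≤ f h zero    = z≤n
shift≤ f h (suc j) = h j

parity : ∀ t → ∃ λ m → t ≡ m + m ⊎ t ≡ suc (m + m)
parity zero = 0 , inj₁ refl
parity (suc t) with parity t
... | m , inj₁ refl = m , inj₂ refl
... | m , inj₂ refl = suc m , inj₁ (cong suc (PE.sym (ℕP.+-suc m m)))

4^m+m : ∀ m → 4 ^ (m + m) ≡ 16 ^ m
4^m+m m = trans (cong (4 ^_) (cong (m +_) (PE.sym (ℕP.+-identityʳ m)))) (PE.sym (ℕP.^-*-assoc 4 2 m))

-- The factor 2 pays for odd rows, whose entries are estimated by twice the central coefficient of
-- the row before.
binomial-bound : ∀ c t j → layer c 0 t j * layer c 0 t j * suc t ≤ 2 * 4 ^ t
binomial-bound c t j with parity t
... | m , inj₁ refl = begin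
  b * b * suc (m + m)                          ≤⟨ ℕP.*-monoˡ-≤ (suc (m + m)) (ℕP.*-mono-≤ (binomial≤middle c m j) (binomial≤middle c m j)) ⟩
  paths m m * paths m m * suc (m + m)          ≤⟨ central-bound m ⟩
  16 ^ m                                       ≡⟨ 4^m+m m ⟨
  4 ^ (m + m)                                  ≤⟨ ℕP.m≤m+n _ _ ⟩
  2 * 4 ^ (m + m)                              ∎
  where
  open ℕP.≤-Reasoning
  b = layer c 0 (m + m) j
... | m , inj₂ refl = begin
  b * b * suc (suc (m + m))                    ≤⟨ ℕP.*-mono-≤ (ℕP.*-mono-≤ b≤ b≤) suc≤ ⟩
  (p + p) * (p + p) * (2 * suc (m + m))        ≡⟨ solve 2 (λ p s → (p :+ p) :* (p :+ p) :* (con 2 :* s) := con 8 :* (p :* p :* s)) refl p (suc (m + m)) ⟩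
  8 * (p * p * suc (m + m))                    ≤⟨ ℕP.*-monoʳ-≤ 8 (central-bound m) ⟩
  8 * 16 ^ m                                   ≡⟨ cong (8 *_) (4^m+m m) ⟨
  8 * 4 ^ (m + m)                              ≡⟨ ℕP.*-assoc 2 4 (4 ^ (m + m)) ⟩
  2 * (4 * 4 ^ (m + m))                        ∎
  where
  open ℕP.≤-Reasoning
  p = paths m m
  b = layer c 0 (suc (m + m)) j
  b≤ : b ≤ p + p
  b≤ = ℕP.+-mono-≤ (binomial≤middle c m j) (shift≤ (layer c 0 (m + m)) (binomial≤middle c m) j)
  suc≤ : suc (suc (m + m)) ≤ 2 * suc (m + m)
  suc≤ = subst (suc (suc (m + m)) ≤_) (solve 1 (λ s → con 1 :+ s :+ (con 1 :+ s) := con 2 :* (con 1 :+ s)) refl (m + m))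
           (s≤s (ℕP.m≤n+m (suc (m + m)) (m + m)))

-- Since 2 (cA + B)² + c (2A − B)² = (c + 2) (2cA² + B²), the two bounds combine to
-- 2 (cA + B)² x (x + k) ≤ 2 k² Q (x + c), and (x + 1) (x + c) ≤ x (x + k).
mix : ∀ c x A B Q → c < x → A * A * x ≤ Q → B * B * (x + (2 + c)) ≤ 4 * Q →
      (B + c * A) * (B + c * A) * suc x ≤ (2 + c) * (2 + c) * Q
mix c x@(suc _) A B Q c<x hA hB = ℕP.*-cancelˡ-≤ (2 * (x * (x + k))) (begin
  2 * (x * (x + k)) * ((B + c * A) * (B + c * A) * suc x)
    ≡⟨ solve 4 (λ X Y Z s → con 2 :* (X :* Y) :* (Z :* s) := con 2 :* Z :* (s :* (X :* Y))) refl x (x + k) ((B + c * A) * (B + c * A)) (suc x) ⟩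
  2 * ((B + c * A) * (B + c * A)) * (suc x * (x * (x + k)))
    ≤⟨ ℕP.*-monoˡ-≤ (suc x * (x * (x + k))) convex ⟩
  k * (2 * c * (A * A) + B * B) * (suc x * (x * (x + k)))
    ≡⟨ solve 6 (λ k c a b s x → k :* (con 2 :* c :* a :+ b) :* (s :* (x :* (x :+ k)))
                 := k :* s :* (con 2 :* c :* (x :+ k) :* (a :* x) :+ x :* (b :* (x :+ k)))) refl k c (A * A) (B * B) (suc x) x ⟩
  k * suc x * (2 * c * (x + k) * (A * A * x) + x * (B * B * (x + k)))
    ≤⟨ ℕP.*-monoʳ-≤ (k * suc x) (ℕP.+-mono-≤ (ℕP.*-monoʳ-≤ (2 * c * (x + k)) hA) (ℕP.*-monoʳ-≤ x hB)) ⟩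
  k * suc x * (2 * c * (x + k) * Q + x * (4 * Q))
    ≡⟨ solve 3 (λ c x q → let k = con 2 :+ c in
                 k :* (con 1 :+ x) :* (con 2 :* c :* (x :+ k) :* q :+ x :* (con 4 :* q))
                 := con 2 :* (k :* k :* q) :* ((con 1 :+ x) :* (x :+ c))) refl c x Q ⟩
  2 * (k * k * Q) * (suc x * (x + c))
    ≤⟨ ℕP.*-monoʳ-≤ (2 * (k * k * Q)) room ⟩
  2 * (k * k * Q) * (x * (x + k))
    ≡⟨ solve 2 (λ q y → con 2 :* q :* y := con 2 :* y :* q) refl (k * k * Q) (x * (x + k)) ⟩
  2 * (x * (x + k)) * (k * k * Q) ∎)
  where
  open ℕP.≤-Reasoning
  k = 2 + c
  room : suc x * (x + c) ≤ x * (x + k)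
  room = begin
    suc x * (x + c)          ≡⟨ solve 2 (λ x c → (con 1 :+ x) :* (x :+ c) := x :* x :+ c :* x :+ x :+ c) refl x c ⟩
    x * x + c * x + x + c    ≤⟨ ℕP.+-monoʳ-≤ (x * x + c * x + x) (ℕP.<⇒≤ c<x) ⟩
    x * x + c * x + x + x    ≡⟨ solve 2 (λ x c → x :* x :+ c :* x :+ x :+ x := x :* (x :+ (con 2 :+ c))) refl x c ⟩
    x * (x + k)              ∎
  -- This is (2 A - B)² ≥ 0, with the square taken of whichever truncated difference is exact.
  cross : 4 * (A * B) ≤ 4 * (A * A) + B * B
  cross with ℕP.≤-total (2 * A) B
  ... | inj₁ 2A≤B = subst (λ B → 4 * (A * B) ≤ 4 * (A * A) + B * B) (ℕP.m+[n∸m]≡n 2A≤B) (begin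
    4 * (A * (2 * A + d))                         ≤⟨ ℕP.m≤m+n _ (d * d) ⟩
    4 * (A * (2 * A + d)) + d * d                 ≡⟨ solve 2 (λ a d → con 4 :* (a :* (con 2 :* a :+ d)) :+ d :* d
                                                       := con 4 :* (a :* a) :+ (con 2 :* a :+ d) :* (con 2 :* a :+ d)) refl A d ⟩
    4 * (A * A) + (2 * A + d) * (2 * A + d)       ∎)
    where d = B ∸ 2 * A
  ... | inj₂ B≤2A = begin
    4 * (A * B)                            ≡⟨ solve 2 (λ a b → con 4 :* (a :* b) := con 2 :* ((con 2 :* a) :* b)) refl A B ⟩
    2 * (2 * A * B)                        ≤⟨ ℕP.m≤m+n _ (d * d) ⟩
    2 * (2 * A * B) + d * d                ≡⟨ cong (λ y → 2 * (y * B) + d * d) (PE.sym (ℕP.m+[n∸m]≡n B≤2A)) ⟩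
    2 * ((B + d) * B) + d * d              ≡⟨ solve 2 (λ b d → con 2 :* ((b :+ d) :* b) :+ d :* d := (b :+ d) :* (b :+ d) :+ b :* b) refl B d ⟩
    (B + d) * (B + d) + B * B              ≡⟨ cong (λ y → y * y + B * B) (ℕP.m+[n∸m]≡n B≤2A) ⟩
    2 * A * (2 * A) + B * B                ≡⟨ solve 2 (λ a b → con 2 :* a :* (con 2 :* a) :+ b :* b := con 4 :* (a :* a) :+ b :* b) refl A B ⟩
    4 * (A * A) + B * B                    ∎
    where d = 2 * A ∸ B
  convex : 2 * ((B + c * A) * (B + c * A)) ≤ k * (2 * c * (A * A) + B * B)
  convex = begin
    2 * ((B + c * A) * (B + c * A))
      ≡⟨ solve 3 (λ a b c → con 2 :* ((b :+ c :* a) :* (b :+ c :* a)) := con 2 :* (b :* b) :+ con 2 :* (c :* c :* (a :* a)) :+ c :* (con 4 :* (a :* b))) refl A B c ⟩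
    2 * (B * B) + 2 * (c * c * (A * A)) + c * (4 * (A * B))
      ≤⟨ ℕP.+-monoʳ-≤ (2 * (B * B) + 2 * (c * c * (A * A))) (ℕP.*-monoʳ-≤ c cross) ⟩
    2 * (B * B) + 2 * (c * c * (A * A)) + c * (4 * (A * A) + B * B)
      ≡⟨ solve 3 (λ a b c → con 2 :* (b :* b) :+ con 2 :* (c :* c :* (a :* a)) :+ c :* (con 4 :* (a :* a) :+ b :* b)
                   := (con 2 :+ c) :* (con 2 :* c :* (a :* a) :+ b :* b)) refl A B c ⟩
    k * (2 * c * (A * A) + B * B) ∎

-- Relative to the total mass `k ^ n * 2 ^ t` the peak is at most √(2k / x), where x = n + k (t +
-- 1). A further coordinate is a fair coin with probability 2 / k, and then x grows by k: by 2 on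
-- average. Only growth by 1 is claimed; the surplus absorbs the convexity of 1 / √x. Having t + 1
-- in place of t ensures c < x, which `mix` requires.
layer-bound : ∀ c n t j → let k = 2 + c ; P = k ^ n * 2 ^ t in
              layer c n t j * layer c n t j * (n + k * suc t) ≤ 2 * k * (P * P)
layer-bound c zero t j = begin
  b * b * (k * suc t)             ≡⟨ solve 3 (λ b k s → b :* b :* (k :* s) := k :* (b :* b :* s)) refl b k (suc t) ⟩
  k * (b * b * suc t)             ≤⟨ ℕP.*-monoʳ-≤ k (binomial-bound c t j) ⟩
  k * (2 * 4 ^ t)                 ≡⟨ solve 2 (λ k p → k :* (con 2 :* p) := con 2 :* k :* p) refl k (4 ^ t) ⟩
  2 * k * 4 ^ t                   ≡⟨ cong (2 * k *_) (square t) ⟩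
  2 * k * (1 * 2 ^ t * (1 * 2 ^ t)) ∎
  where
  open ℕP.≤-Reasoning
  k = 2 + c
  b = layer c 0 t j
  square : ∀ t → 4 ^ t ≡ 1 * 2 ^ t * (1 * 2 ^ t)
  square zero    = refl
  square (suc t) = trans (cong (4 *_) (square t))
    (solve 1 (λ p → con 4 :* (con 1 :* p :* (con 1 :* p)) := con 1 :* (con 2 :* p) :* (con 1 :* (con 2 :* p))) refl (2 ^ t))
layer-bound c (suc n) t j = subst (layer c (suc n) t j * layer c (suc n) t j * suc x ≤_)
  (solve 3 (λ k p q → k :* k :* (con 2 :* k :* (p :* q :* (p :* q))) := con 2 :* k :* (k :* p :* q :* (k :* p :* q))) refl k (k ^ n) (2 ^ t))
  (mix c x (shift (layer c n t) j) (layer c n (suc t) j) Q c<x (below j) twice)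
  where
  k = 2 + c
  x = n + k * suc t
  Q = 2 * k * ((k ^ n * 2 ^ t) * (k ^ n * 2 ^ t))
  c<x : c < x
  c<x = ℕP.≤-trans (ℕP.n≤1+n (suc c)) (ℕP.≤-trans (ℕP.m≤m*n k (suc t)) (ℕP.m≤n+m _ n))
  below : ∀ j → shift (layer c n t) j * shift (layer c n t) j * x ≤ Q
  below zero    = z≤n
  below (suc j) = layer-bound c n t j
  twice : layer c n (suc t) j * layer c n (suc t) j * (x + k) ≤ 4 * Q
  twice = subst₂ (λ y q → layer c n (suc t) j * layer c n (suc t) j * y ≤ q)
    (solve 3 (λ n k t → n :+ k :* (con 1 :+ (con 1 :+ t)) := (n :+ k :* (con 1 :+ t)) :+ k) refl n k t)
    (solve 3 (λ k p q → con 2 :* k :* (p :* (con 2 :* q) :* (p :* (con 2 :* q))) := con 4 :* (con 2 :* k :* (p :* q :* (p :* q)))) refl k (k ^ n) (2 ^ t))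
    (layer-bound c n (suc t) j)

-- Sparse expanders

count : ∀ {A : Set} {P : A → Set} → (∀ a → Dec (P a)) → List A → ℕ
count P? []       = 0
count P? (a ∷ as) = ind (P? a) + count P? as

filter-¬+count : ∀ {A : Set} {P : A → Set} (P? : ∀ a → Dec (P a)) as →
                 length (filter (λ a → ¬? (P? a)) as) + count P? as ≡ length as
filter-¬+count P? []       = refl
filter-¬+count P? (a ∷ as) with P? a
... | yes _ = trans (ℕP.+-suc _ _) (cong suc (filter-¬+count P? as))
... | no _  = cong suc (filter-¬+count P? as)

-- Colours one and two mark a pair of disjoint vertex sets, colour zero the rest. Vectors can be
-- listed exhaustively without function extensionality.
Colouring : ℕ → Set
Colouring = Vec (Fin 3)

colourings : ∀ m → List (Colouring m)
colourings zero    = [] ∷ []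
colourings (suc m) = cartesianProductWith _∷_ (allFin 3) (colourings m)

∈-colourings : ∀ {m} (f : Colouring m) → f ∈ colourings m
∈-colourings []      = here refl
∈-colourings (x ∷ f) = ∈-cartesianProductWith⁺ _∷_ (∈-allFin x) (∈-colourings f)

length-cartesianProductWith : ∀ {A B C : Set} (f : A → B → C) xs ys →
                              length (cartesianProductWith f xs ys) ≡ length xs * length ys
length-cartesianProductWith f []       ys = refl
length-cartesianProductWith f (x ∷ xs) ys =
  trans (length-++ (map (f x) ys)) (cong₂ _+_ (length-map (f x) ys) (length-cartesianProductWith f xs ys))

length-colourings : ∀ m → length (colourings m) ≡ 3 ^ m
length-colourings zero    = refl
length-colourings (suc m) = trans (length-cartesianProductWith _∷_ (allFin 3) (colourings m)) (cong (3 *_) (length-colourings m))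

module _ {m : ℕ} where

  class : Fin 3 → Colouring m → ℕ
  class c f = sumFin m (λ x → ind (lookup f x FP.≟ c))

  Balanced : ℕ → Colouring m → Set
  Balanced w f = w ≤ class (suc zero) f × w ≤ class (suc (suc zero)) f

  balanced? : ∀ w f → Dec (Balanced w f)
  balanced? w f = (w ≤? class (suc zero) f) ×-dec (w ≤? class (suc (suc zero)) f)

  Hit : Colouring m → Fin m × Fin m → Set
  Hit f (x , y) = lookup f x ≡ suc zero × lookup f y ≡ suc (suc zero)

  hit? : ∀ f p → Dec (Hit f p)
  hit? f (x , y) = (lookup f x FP.≟ suc zero) ×-dec (lookup f y FP.≟ suc (suc zero))

  hits : List (Colouring m) → Fin m × Fin m → ℕ
  hits L p = count (λ f → hit? f p) L

  unhit : List (Colouring m) → Fin m × Fin m → List (Colouring m)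
  unhit L p = filter (λ f → ¬? (hit? f p)) L

  unhit+hits : ∀ L p → length (unhit L p) + hits L p ≡ length L
  unhit+hits L p = filter-¬+count (λ f → hit? f p) L

  pairSum : (Fin m × Fin m → ℕ) → ℕ
  pairSum g = sumFin m λ x → sumFin m λ y → g (x , y)

  pairSum-+ : ∀ g h → pairSum (λ p → g p + h p) ≡ pairSum g + pairSum h
  pairSum-+ g h = trans (sum-cong m (λ x → sum-+ m _ _)) (sum-+ m _ _)

  -- Double counting: a colouring is hit by the product of its two class sizes, at least w² pairs.
  hits-total : ∀ {w} L → All (Balanced w) L → length L * (w * w) ≤ pairSum (hits L)
  hits-total []      []              = z≤n
  hits-total {w} (f ∷ L) ((a , b) ∷ bal) = begin
    w * w + length L * (w * w)                                         ≤⟨ ℕP.+-mono-≤ (ℕP.*-mono-≤ a b) (hits-total L bal) ⟩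
    class (suc zero) f * class (suc (suc zero)) f + pairSum (hits L)   ≡⟨ cong (_+ pairSum (hits L)) (sum-product m m _ _) ⟨
    pairSum (λ { (x , y) → ind (lookup f x FP.≟ suc zero) * ind (lookup f y FP.≟ suc (suc zero)) }) + pairSum (hits L)
      ≡⟨ cong (_+ pairSum (hits L)) (sum-cong m λ x → sum-cong m λ y → PE.sym (ind-× (lookup f x FP.≟ suc zero) (lookup f y FP.≟ suc (suc zero)))) ⟩
    pairSum (λ p → ind (hit? f p)) + pairSum (hits L)                  ≡⟨ pairSum-+ (λ p → ind (hit? f p)) (hits L) ⟨
    pairSum (hits (f ∷ L))                                             ∎
    where open ℕP.≤-Reasoning

  average : ∀ {w} → m ≡ 4 * w → 1 ≤ m → ∀ L → All (Balanced w) L → ∃ λ p → length L ≤ 16 * hits L p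
  average {w} m≡ 1≤m L bal with FP.any? (λ x → FP.any? λ y → length L ≤? 16 * hits L (x , y))
  ... | yes (x , y , le) = (x , y) , le
  -- If every one of the m² = 16 w² pairs stayed strictly below the average, summation would leave a
  -- surplus of m² > 0.
  ... | no none = ⊥-elim (ℕP.<⇒≱ (ℕP.*-mono-≤ 1≤m 1≤m) (ℕP.+-cancelʳ-≤ (16 * pairSum (hits L)) (m * m) 0 (begin
    m * m + 16 * pairSum (hits L)                     ≡⟨ expand ⟨
    pairSum (λ p → 1 + 16 * hits L p)                 ≤⟨ sum-mono m (λ x → sum-mono m (λ y → ℕP.≰⇒> (λ le → none (x , y , le)))) ⟩
    pairSum (λ _ → length L)                          ≡⟨ trans (sum-cong m (λ _ → sum-const m _)) (sum-const m _) ⟩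
    m * (m * length L)                                ≡⟨ cong (λ m → m * (m * length L)) m≡ ⟩
    4 * w * (4 * w * length L)                        ≡⟨ solve 2 (λ w l → con 4 :* w :* (con 4 :* w :* l) := con 16 :* (l :* (w :* w))) refl w (length L) ⟩
    16 * (length L * (w * w))                         ≤⟨ ℕP.*-monoʳ-≤ 16 (hits-total L bal) ⟩
    0 + 16 * pairSum (hits L)                         ∎)))
    where
    open ℕP.≤-Reasoning
    expand : pairSum (λ p → 1 + 16 * hits L p) ≡ m * m + 16 * pairSum (hits L)
    expand = trans (pairSum-+ (λ _ → 1) (λ p → 16 * hits L p))
      (cong₂ _+_ (trans (sum-cong m (λ _ → trans (sum-const m 1) (ℕP.*-identityʳ m))) (sum-const m m))
                 (trans (sum-cong m (λ x → sum-* m 16 _)) (sum-* m 16 _)))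

  greedy : ∀ {w} → m ≡ 4 * w → 1 ≤ m → ∀ j L → All (Balanced w) L →
           ∃ λ Es → length Es ≡ j × ∃ λ L′ → 16 ^ j * length L′ ≤ 15 ^ j * length L ×
             (∀ {f} → f ∈ L → f ∈ L′ ⊎ Any (Hit f) Es)
  greedy m≡ 1≤m zero    L bal = [] , refl , L , ℕP.≤-refl , inj₁
  greedy m≡ 1≤m (suc j) L bal with average m≡ 1≤m L bal
  ... | p , many with greedy m≡ 1≤m j (unhit L p) (filter⁺ (λ f → ¬? (hit? f p)) bal)
  ... | Es , len , L′ , le , cover = p ∷ Es , cong suc len , L′ , le′ , cover′
    where
    open ℕP.≤-Reasoning
    shrink : 16 * length (unhit L p) ≤ 15 * length L
    shrink = ℕP.+-cancelʳ-≤ (length L) _ _ (begin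
      16 * length (unhit L p) + length L              ≤⟨ ℕP.+-monoʳ-≤ (16 * length (unhit L p)) many ⟩
      16 * length (unhit L p) + 16 * hits L p         ≡⟨ ℕP.*-distribˡ-+ 16 (length (unhit L p)) _ ⟨
      16 * (length (unhit L p) + hits L p)            ≡⟨ cong (16 *_) (unhit+hits L p) ⟩
      16 * length L                                   ≡⟨ ℕP.+-comm (length L) _ ⟩
      15 * length L + length L                        ∎)
    le′ : 16 ^ suc j * length L′ ≤ 15 ^ suc j * length L
    le′ = begin
      16 * 16 ^ j * length L′                  ≡⟨ ℕP.*-assoc 16 (16 ^ j) _ ⟩
      16 * (16 ^ j * length L′)                ≤⟨ ℕP.*-monoʳ-≤ 16 le ⟩
      16 * (15 ^ j * length (unhit L p))       ≡⟨ solve 2 (λ a b → con 16 :* (a :* b) := a :* (con 16 :* b)) refl (15 ^ j) (length (unhit L p)) ⟩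
      15 ^ j * (16 * length (unhit L p))       ≤⟨ ℕP.*-monoʳ-≤ (15 ^ j) shrink ⟩
      15 ^ j * (15 * length L)                 ≡⟨ solve 2 (λ a b → a :* (con 15 :* b) := con 15 :* a :* b) refl (15 ^ j) (length L) ⟩
      15 * 15 ^ j * length L                   ∎
    cover′ : ∀ {f} → f ∈ L → f ∈ L′ ⊎ Any (Hit f) (p ∷ Es)
    cover′ {f} f∈ with hit? f p
    ... | yes h = inj₂ (here h)
    ... | no ¬h = Sum.map₂ there (cover (∈-filter⁺ (λ f → ¬? (hit? f p)) f∈ ¬h))

-- Every choice of a pair leaves at most 15/16 of the colourings, and there are at most 3 per vertex
-- to be beaten: log 3 / log (16/15) ≈ 17.02, so 18 pairs per vertex suffice.
power-gap : 15 ^ 18 * 3 < 16 ^ 18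
power-gap = ℕP.<ᵇ⇒< (15 ^ 18 * 3) (16 ^ 18) tt

powers : ∀ a b r c m → .{{NonZero m}} → a ^ r * c < b ^ r → a ^ (r * m) * c ^ m < b ^ (r * m)
powers a b r c m gap = subst₂ _<_
  (trans (distrib m (a ^ r) c) (cong (_* c ^ m) (ℕP.^-*-assoc a r m))) (ℕP.^-*-assoc b r m) (ℕP.^-monoˡ-< m gap)
  where
  distrib : ∀ m x y → (x * y) ^ m ≡ x ^ m * y ^ m
  distrib zero    x y = refl
  distrib (suc m) x y rewrite distrib m x y =
    solve 4 (λ x y p q → x :* y :* (p :* q) := x :* p :* (y :* q)) refl x y (x ^ m) (y ^ m)

-- A sparse expander: each of the at most 3ᵐ balanced colourings is hit by a sixteenth of all pairs, so that
-- repeatedly choosing a pair that hits as many of the remaining ones as possible exhausts them after 18 m steps.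
expander : ∀ w m → m ≡ 4 * w → 1 ≤ m → ∃ λ (Es : List (Fin m × Fin m)) → length Es ≡ 18 * m ×
           (∀ (f : Colouring m) → Balanced w f → Any (Hit f) Es)
expander w m m≡ 1≤m with greedy m≡ 1≤m (18 * m) (filter (balanced? w) (colourings m)) (all-filter (balanced? w) (colourings m))
... | Es , len , L′ , le , cover = Es , len , λ f bal →
  [ (λ f∈ → ⊥-elim (empty L′ le f∈)) , (λ h → h) ]′ (cover (∈-filter⁺ (balanced? w) (∈-colourings f) bal))
  where
  open ℕP.≤-Reasoning
  L = filter (balanced? w) (colourings m)
  empty : ∀ L′ → 16 ^ (18 * m) * length L′ ≤ 15 ^ (18 * m) * length L → ∀ {f} → ¬ f ∈ L′
  empty (_ ∷ L′) le _ = ℕP.<⇒≱ (powers 15 16 18 3 m {{>-nonZero 1≤m}} power-gap) (begin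
    16 ^ (18 * m)                          ≤⟨ ℕP.m≤m*n (16 ^ (18 * m)) (suc (length L′)) ⟩
    16 ^ (18 * m) * suc (length L′)        ≤⟨ le ⟩
    15 ^ (18 * m) * length L               ≤⟨ ℕP.*-monoʳ-≤ (15 ^ (18 * m)) (length-filter (balanced? w) (colourings m)) ⟩
    15 ^ (18 * m) * length (colourings m)  ≡⟨ cong (15 ^ (18 * m) *_) (length-colourings m) ⟩
    15 ^ (18 * m) * 3 ^ m                  ∎)

-- Graphs from lists of pairs.

module FromPairs {m : ℕ} (Es : List (Fin m × Fin m)) where

  open DecMembership (≡-dec (FP._≟_ {m}) (FP._≟_ {m})) using (_∈?_)

  graph : Graph m
  graph = record
    { Adj  = λ x y → x ≢ y × ((x , y) ∈ Es ⊎ (y , x) ∈ Es)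
    ; adj? = λ x y → ¬? (x FP.≟ y) ×-dec (((x , y) ∈? Es) ⊎-dec ((y , x) ∈? Es))
    ; sym  = λ { (ne , e) → (λ p → ne (PE.sym p)) , Sum.swap e }
    ; irr  = λ { (ne , _) → ne refl }
    }

  occurrences : List (Fin m × Fin m) → Fin m → Fin m → ℕ
  occurrences []            x y = 0
  occurrences ((a , b) ∷ E) x y = ind (a FP.≟ x) * ind (b FP.≟ y) + occurrences E x y

  ∈-occurrences : ∀ {E x y} → (x , y) ∈ E → 1 ≤ occurrences E x y
  ∈-occurrences {(a , b) ∷ E} {x} {y} (here refl) with a FP.≟ a | b FP.≟ b
  ... | yes _ | yes _ = s≤s z≤n
  ... | no ¬p | _     = ⊥-elim (¬p refl)
  ... | _     | no ¬p = ⊥-elim (¬p refl)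
  ∈-occurrences {p ∷ E} (there q) = ℕP.≤-trans (∈-occurrences q) (ℕP.m≤n+m _ _)

  occurrences-total : ∀ E → sumFin m (λ x → sumFin m (λ y → occurrences E x y)) ≤ length E
  occurrences-total []            = ℕP.≤-reflexive (trans (sum-cong m (λ _ → trans (sum-const m 0) (ℕP.*-zeroʳ m))) (trans (sum-const m 0) (ℕP.*-zeroʳ m)))
  occurrences-total ((a , b) ∷ E) = begin
    sumFin m (λ x → sumFin m (λ y → ind (a FP.≟ x) * ind (b FP.≟ y) + occurrences E x y))
      ≡⟨ trans (sum-cong m (λ x → sum-+ m _ _)) (sum-+ m _ _) ⟩
    sumFin m (λ x → sumFin m (λ y → ind (a FP.≟ x) * ind (b FP.≟ y))) + sumFin m (λ x → sumFin m (λ y → occurrences E x y))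
      ≤⟨ ℕP.+-mono-≤ (ℕP.≤-trans (ℕP.≤-reflexive (sum-product m m (λ x → ind (a FP.≟ x)) (λ y → ind (b FP.≟ y))))
                                 (ℕP.*-mono-≤ (sum-unique m (a FP.≟_) (λ p q → trans (PE.sym p) q))
                                              (sum-unique m (b FP.≟_) (λ p q → trans (PE.sym p) q))))
                     (occurrences-total E) ⟩
    1 + length E ∎
    where open ℕP.≤-Reasoning

  -- An edge is charged to a listed pair in either orientation; summing the two orientations
  -- separately gives the factor 2.
  edgeCount-graph : edgeCount graph ≤ 2 * length Es
  edgeCount-graph = begin
    edgeCount graph
      ≤⟨ sum-mono m (λ x → sum-mono m (λ y → edge x y)) ⟩
    sumFin m (λ x → sumFin m (λ y → occurrences Es x y + occurrences Es y x))
      ≡⟨ trans (sum-cong m (λ x → sum-+ m _ _)) (sum-+ m _ _) ⟩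
    sumFin m (λ x → sumFin m (λ y → occurrences Es x y)) + sumFin m (λ x → sumFin m (λ y → occurrences Es y x))
      ≡⟨ cong (sumFin m (λ x → sumFin m (λ y → occurrences Es x y)) +_) (sum-swap m m (λ x y → occurrences Es y x)) ⟩
    sumFin m (λ x → sumFin m (λ y → occurrences Es x y)) + sumFin m (λ x → sumFin m (λ y → occurrences Es x y))
      ≤⟨ ℕP.+-mono-≤ (occurrences-total Es) (occurrences-total Es) ⟩
    length Es + length Es
      ≡⟨ cong (length Es +_) (ℕP.+-identityʳ _) ⟨
    2 * length Es ∎
    where
    open ℕP.≤-Reasoning
    edge : ∀ x y → (if isYes ((x FP.<? y) ×-dec adj? graph x y) then 1 else 0) ≤ occurrences Es x y + occurrences Es y x
    edge x y with (x FP.<? y) ×-dec adj? graph x y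
    ... | no _ = z≤n
    ... | yes (_ , _ , inj₁ p) = ℕP.≤-trans (∈-occurrences p) (ℕP.m≤m+n _ _)
    ... | yes (_ , _ , inj₂ p) = ℕP.≤-trans (∈-occurrences p) (ℕP.m≤n+m _ _)

-- Products of small graphs are not universal

nonzero : ∀ {m} → Fin m → ℕ
nonzero zero    = 0
nonzero (suc _) = 1

nonzero≤1 : ∀ {m} (a : Fin m) → nonzero a ≤ 1
nonzero≤1 zero    = z≤n
nonzero≤1 (suc _) = ℕP.≤-refl

weight : ∀ n v → Point n v → ℕ
weight zero    v x = 0
weight (suc n) v x = nonzero (head n v x) + weight n (λ i → v (suc i)) (tail n v x)

weight-adj : ∀ n v (G : ∀ i → Graph (v i)) {x y} → Adj (prodGraph n v G) x y → weight n v x ≤ suc (weight n v y)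
weight-adj (suc n) v G {x} {y} (inj₁ (p , e)) = begin
  nonzero (head n v x) + weight n v′ (tail n v x)        ≤⟨ ℕP.+-mono-≤ (ℕP.≤-reflexive (cong nonzero p)) (weight-adj n v′ (λ i → G (suc i)) e) ⟩
  nonzero (head n v y) + suc (weight n v′ (tail n v y))  ≡⟨ ℕP.+-suc _ _ ⟩
  suc (weight (suc n) v y)                               ∎
  where
  open ℕP.≤-Reasoning
  v′ = λ i → v (suc i)
weight-adj (suc n) v G {x} {y} (inj₂ (e , p)) =
  ℕP.+-mono-≤ (nonzero≤1 (head n v x)) (ℕP.≤-trans (ℕP.≤-reflexive (cong (weight n (λ i → v (suc i))) p)) (ℕP.m≤n+m _ (nonzero (head n v y))))

sum-nonzero : ∀ {c} m → m ≤ 2 + c → (h : ℕ → ℕ) → sumFin m (λ a → h (nonzero a)) ≤ h 0 + suc c * h 1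
sum-nonzero zero    _ h = z≤n
sum-nonzero {c} (suc m) (s≤s m≤) h = ℕP.+-monoʳ-≤ (h 0) (subst (_≤ suc c * h 1) (PE.sym (sum-const m (h 1))) (ℕP.*-monoˡ-≤ (h 1) m≤))

-- Smaller factors only lose points, so the recursion `layer-suc` for factors of full size bounds
-- them all.
weight-count : ∀ {c} n v → (∀ i → v i ≤ 2 + c) → ∀ t → sumFin (prodSize n v) (λ x → ind (weight n v x ℕP.≟ t)) ≤ layer c n 0 t
weight-count zero v v≤ zero    = ℕP.≤-refl
weight-count zero v v≤ (suc t) = z≤n
weight-count {c} (suc n) v v≤ t = begin
  sumFin (prodSize (suc n) v) (λ x → ind (weight (suc n) v x ℕP.≟ t))
    ≡⟨ sum-combine (v zero) N _ ⟩
  sumFin (v zero) (λ a → sumFin N (λ b → ind (weight (suc n) v (combine a b) ℕP.≟ t)))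
    ≡⟨ sum-cong (v zero) (λ a → sum-cong N (λ b → cong (λ s → ind (s ℕP.≟ t))
         (cong₂ (λ a b → nonzero a + weight n v′ b) (head-combine n v a b) (tail-combine n v a b)))) ⟩
  sumFin (v zero) (λ a → h (nonzero a))
    ≤⟨ sum-nonzero (v zero) (v≤ zero) h ⟩
  h 0 + suc c * h 1
    ≤⟨ ℕP.+-mono-≤ (weight-count n v′ (λ i → v≤ (suc i)) t) (ℕP.*-monoʳ-≤ (suc c) (h₁ t)) ⟩
  layer c n 0 t + suc c * shift (layer c n 0) t
    ≡⟨ layer-suc c n t ⟨
  layer c (suc n) 0 t ∎
  where
  open ℕP.≤-Reasoning
  v′ = λ i → v (suc i)
  N = prodSize n v′
  h : ℕ → ℕ
  h d = sumFin N (λ b → ind (d + weight n v′ b ℕP.≟ t))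
  h₁ : ∀ t → sumFin N (λ b → ind (suc (weight n v′ b) ℕP.≟ t)) ≤ shift (layer c n 0) t
  h₁ zero    = ℕP.≤-reflexive (trans (sum-const N 0) (ℕP.*-zeroʳ N))
  h₁ (suc t) = ℕP.≤-trans (sum-mono N (λ b → ind-mono (suc (weight n v′ b) ℕP.≟ suc t) (weight n v′ b ℕP.≟ t) ℕP.suc-injective))
                          (weight-count n v′ (λ i → v≤ (suc i)) t)

-- Every interval is a single bag, the weight of the point. Since `close` permits consecutive bags,
-- one layer forms a bag and no union of two is needed.
prodGraph-layered : ∀ {c} n v (G : ∀ i → Graph (v i)) → (∀ i → v i ≤ 2 + c) → ∀ {w} → (∀ t → layer c n 0 t ≤ w) →
                    Layered (prodGraph n v G) w
prodGraph-layered n v G v≤ {w} layer≤ = record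
  { lo = weight n v ; hi = weight n v ; lo≤hi = λ _ → ℕP.≤-refl ; close = weight-adj n v G
  ; thin = λ t → ℕP.≤-trans (sum-mono (prodSize n v) (λ x → ind-mono (between? (weight n v x) (weight n v x) t) (weight n v x ℕP.≟ t)
                              (λ { (p , q) → ℕP.≤-antisym p q })))
                            (ℕP.≤-trans (weight-count n v v≤ t) (layer≤ t)) }

-- Expanders against thin layers.

crossing : ∀ {P : ℕ → Set} → (∀ t → Dec (P t)) → ∀ T → P 0 → ¬ P T → ∃ λ t → P t × ¬ P (suc t)
crossing P? zero    p ¬p = ⊥-elim (¬p p)
crossing P? (suc T) p ¬p with P? T
... | yes q = T , q , ¬p
... | no ¬q = crossing P? T p ¬q

-- The rounded-down value of √(Z / q). Its maximality makes it an upper bound for all layer sizes,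
-- while its own inequality limits the number of edges of the expander built from it.
root : ∀ q Z → 1 ≤ q → ∃ λ w → w * w * q ≤ Z × (∀ b → b * b * q ≤ Z → b ≤ w)
root q Z 1≤q with crossing (λ w → w * w * q ≤? Z) (suc Z) z≤n
                    (λ le → ℕP.<⇒≱ (ℕP.≤-trans (ℕP.m≤m*n (suc Z) (suc Z)) (ℕP.≤-trans (ℕP.≤-reflexive (PE.sym (ℕP.*-identityʳ _))) (ℕP.*-monoʳ-≤ (suc Z * suc Z) 1≤q))) le)
... | w , below , above = w , below , λ b le → ℕP.≮⇒≥ λ w<b →
  above (ℕP.≤-trans (ℕP.*-monoˡ-≤ q (ℕP.*-mono-≤ w<b w<b)) le)

-- Take t such that fewer than w intervals end before t but at least w end by t. Of the 4 w
-- vertices, at most w ended earlier and at most 2 w meet the bags t and t + 1, so at least w start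
-- after t + 1. These are not adjacent to the ones that ended by t: bag t + 1 must be skipped
-- because edges may join consecutive bags.
no-thin-expander : ∀ {m w} {H : Graph m} → m ≡ 4 * w → 1 ≤ w →
                   (∀ f → Balanced w f → ∃ λ x → ∃ λ y → Hit f (x , y) × Adj H x y) → ¬ Layered H w
-- The sum of all right ends is a bag number beyond which no interval reaches.
no-thin-expander {m} {w} {H} m≡ 1≤w expand L with crossing (λ t → ended t <? w) (suc (sumFin m hi)) start finish
  where
  open Layered L
  ended : ℕ → ℕ
  ended t = sumFin m (λ x → ind (hi x <? t))
  start : ended 0 < w
  start = subst (_< w) (PE.sym (trans (sum-cong m (λ x → ind-no (hi x <? 0) λ ())) (trans (sum-const m 0) (ℕP.*-zeroʳ m)))) 1≤w
    where
    ind-no : ∀ {P : Set} (p : Dec P) → ¬ P → ind p ≡ 0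
    ind-no (yes p) ¬p = ⊥-elim (¬p p)
    ind-no (no _)  _  = refl
  finish : ¬ ended (suc (sumFin m hi)) < w
  finish lt = ℕP.<⇒≱ lt (begin
    w                                       ≤⟨ ℕP.m≤m+n w _ ⟩
    4 * w                                   ≡⟨ m≡ ⟨
    m                                       ≡⟨ trans (sum-const m 1) (ℕP.*-identityʳ m) ⟨
    sumFin m (λ _ → 1)                      ≤⟨ sum-mono m (λ x → ind-mono (yes (s≤s (term≤sum m hi x))) (hi x <? suc (sumFin m hi)) (λ p → p)) ⟩
    ended (suc (sumFin m hi))               ∎)
    where open ℕP.≤-Reasoning
... | t , few , many = contradict (expand f (ℕP.≤-trans (ℕP.≮⇒≥ many) left , right))
  where
  open Layered L
  colour : Fin m → Fin 3
  colour x with hi x ≤? t | suc t <? lo x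
  ... | yes _ | _     = suc zero
  ... | no _  | yes _ = suc (suc zero)
  ... | no _  | no _  = zero
  f : Colouring m
  f = tabulate colour
  colour-left : ∀ x → hi x ≤ t → colour x ≡ suc zero
  colour-left x p with hi x ≤? t
  ... | yes _ = refl
  ... | no ¬p = ⊥-elim (¬p p)
  colour-right : ∀ x → suc t < lo x → colour x ≡ suc (suc zero)
  colour-right x p with hi x ≤? t | suc t <? lo x
  ... | yes q | _     = ⊥-elim (ℕP.<⇒≱ (ℕP.<-trans (ℕP.n<1+n t) p) (ℕP.≤-trans (lo≤hi x) q))
  ... | no _  | yes _ = refl
  ... | no _  | no ¬p = ⊥-elim (¬p p)
  left⇒ : ∀ x → colour x ≡ suc zero → hi x ≤ t
  left⇒ x eq with hi x ≤? t | suc t <? lo x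
  left⇒ x eq | yes p | _ = p
  left⇒ x () | no _  | yes _
  left⇒ x () | no _  | no _
  right⇒ : ∀ x → colour x ≡ suc (suc zero) → suc t < lo x
  right⇒ x eq with hi x ≤? t | suc t <? lo x
  right⇒ x () | yes _ | _
  right⇒ x eq | no _  | yes p = p
  right⇒ x () | no _  | no _
  left : sumFin m (λ x → ind (hi x <? suc t)) ≤ class (suc zero) f
  left = sum-mono m (λ x → ind-mono (hi x <? suc t) (lookup f x FP.≟ suc zero)
           (λ p → trans (lookup∘tabulate colour x) (colour-left x (ℕP.≤-pred p))))
  cover : ∀ x → 1 ≤ ind (hi x <? t) + (ind (between? (lo x) (hi x) t) + (ind (between? (lo x) (hi x) (suc t)) + ind (lookup f x FP.≟ suc (suc zero))))
  cover x with hi x <? t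
  ... | yes _ = s≤s z≤n
  ... | no hi≮t with between? (lo x) (hi x) t
  ...   | yes _ = s≤s z≤n
  ...   | no ∉t with between? (lo x) (hi x) (suc t)
  ...     | yes _ = s≤s z≤n
  ...     | no ∉st with lookup f x FP.≟ suc (suc zero)
  ...       | yes _ = s≤s z≤n
  ...       | no ≢2 = ⊥-elim (≢2 (trans (lookup∘tabulate colour x) (colour-right x st<lo)))
    where
    t<lo : t < lo x
    t<lo = ℕP.≰⇒> λ lo≤t → ∉t (lo≤t , ℕP.≮⇒≥ hi≮t)
    st<lo : suc t < lo x
    st<lo = ℕP.≰⇒> λ lo≤st → ∉st (lo≤st , ℕP.≤-trans t<lo (lo≤hi x))
  right : w ≤ class (suc (suc zero)) f
  right = ℕP.+-cancelˡ-≤ (w + (w + w)) w _ (begin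
    w + (w + w) + w                               ≡⟨ solve 1 (λ w → w :+ (w :+ w) :+ w := con 4 :* w) refl w ⟩
    4 * w                                         ≡⟨ m≡ ⟨
    m                                             ≡⟨ trans (sum-const m 1) (ℕP.*-identityʳ m) ⟨
    sumFin m (λ _ → 1)                            ≤⟨ sum-mono m cover ⟩
    sumFin m (λ x → ind (hi x <? t) + (ind (between? (lo x) (hi x) t) + (ind (between? (lo x) (hi x) (suc t)) + ind (lookup f x FP.≟ suc (suc zero)))))
      ≡⟨ trans (sum-+ m _ _) (cong (ended +_) (trans (sum-+ m _ _) (cong (bag t +_) (sum-+ m _ _)))) ⟩
    ended + (bag t + (bag (suc t) + class (suc (suc zero)) f))
      ≤⟨ ℕP.+-mono-≤ (ℕP.<⇒≤ few) (ℕP.+-mono-≤ (thin t) (ℕP.+-monoˡ-≤ (class (suc (suc zero)) f) (thin (suc t)))) ⟩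
    w + (w + (w + class (suc (suc zero)) f))      ≡⟨ solve 2 (λ w c → w :+ (w :+ (w :+ c)) := w :+ (w :+ w) :+ c) refl w (class (suc (suc zero)) f) ⟩
    w + (w + w) + class (suc (suc zero)) f        ∎)
    where
    open ℕP.≤-Reasoning
    ended = sumFin m (λ x → ind (hi x <? t))
    bag : ℕ → ℕ
    bag s = sumFin m (λ x → ind (between? (lo x) (hi x) s))
  contradict : ¬ ∃ λ x → ∃ λ y → Hit f (x , y) × Adj H x y
  contradict (x , y , (fx , fy) , e) =
    ℕP.<⇒≱ (right⇒ y (trans (PE.sym (lookup∘tabulate colour y)) fy))
      (ℕP.≤-trans (close (sym H e)) (s≤s (left⇒ x (trans (PE.sym (lookup∘tabulate colour x)) fx))))

another : ∀ {m} → 2 ≤ m → (x : Fin m) → ∃ λ y → x ≢ y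
another (s≤s (s≤s _)) zero    = suc zero , λ ()
another (s≤s (s≤s _)) (suc x) = zero , λ ()

SparseExpander : (d w m : ℕ) → Set₁
SparseExpander d w m = ∃ λ (H : Graph m) → NoIsolated H × edgeCount H ≤ d * w ×
                       (∀ f → Balanced w f → ∃ λ x → ∃ λ y → Hit f (x , y) × Adj H x y)

-- An extra pair at every vertex prevents isolated vertices. The 4 w extra pairs and the 18 · 4 w
-- expanding ones, doubled by `edgeCount-graph`, give 2 (4 + 72) w = 152 w.
sparse-expander : ∀ w m → m ≡ 4 * w → 1 ≤ w → SparseExpander 152 w m
sparse-expander w m m≡ 1≤w with expander w m m≡ (subst (1 ≤_) (PE.sym m≡) (ℕP.≤-trans 1≤w (ℕP.m≤m+n w _)))
... | Es , len , hit = graph , (λ x → proj₁ (another 2≤m x) , proj₂ (another 2≤m x) , inj₁ (∈-++⁺ˡ (∈-map⁺ link (∈-allFin x)))) ,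
  edges≤ , λ f bal → let ((x , y) , p∈ , h) = find (hit f bal) in x , y , h , differ f h , inj₁ (∈-++⁺ʳ links p∈)
  where
  2≤m : 2 ≤ m
  2≤m = subst (2 ≤_) (PE.sym m≡) (ℕP.≤-trans (s≤s (s≤s z≤n)) (ℕP.*-monoʳ-≤ 4 1≤w))
  link : Fin m → Fin m × Fin m
  link x = x , proj₁ (another 2≤m x)
  links : List (Fin m × Fin m)
  links = map link (allFin m)
  open FromPairs (links ++ Es)
  differ : ∀ f {x y} → Hit f (x , y) → x ≢ y
  differ f (p , q) refl with trans (PE.sym p) q
  ... | ()
  edges≤ : edgeCount graph ≤ 152 * w
  edges≤ = begin
    edgeCount graph                    ≤⟨ edgeCount-graph ⟩
    2 * length (links ++ Es)           ≡⟨ cong (2 *_) (trans (length-++ links) (cong₂ _+_ (trans (length-map link (allFin m)) (length-tabulate {n = m} (λ x → x))) len)) ⟩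
    2 * (m + 18 * m)                   ≡⟨ cong (λ m → 2 * (m + 18 * m)) m≡ ⟩
    2 * (4 * w + 18 * (4 * w))         ≡⟨ solve 4 (λ a b c w → a :* (b :* w :+ c :* (b :* w)) := a :* (b :+ c :* b) :* w) refl 2 4 18 w ⟩
    152 * w                            ∎
    where open ℕP.≤-Reasoning

-- The estimate yields the constant d² · 2k, which is enlarged to d² (2k)², so that it is the square
-- of the natural number C = 2 d k.
scale-bound : ∀ d e k n q w K .{{_ : NonZero (2 * k)}} → e ≤ d * w → n ≤ q → w * w * q ≤ 2 * k * (K * K) →
              e * e * n ≤ 2 * d * k * (2 * d * k) * (K * K)
scale-bound d e k n q w K e≤ n≤ hw = begin
  e * e * n                                ≤⟨ ℕP.*-mono-≤ (ℕP.*-mono-≤ e≤ e≤) n≤ ⟩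
  d * w * (d * w) * q                      ≡⟨ solve 3 (λ d w q → d :* w :* (d :* w) :* q := d :* d :* (w :* w :* q)) refl d w q ⟩
  d * d * (w * w * q)                      ≤⟨ ℕP.*-monoʳ-≤ (d * d) hw ⟩
  d * d * (2 * k * (K * K))                ≤⟨ ℕP.*-monoʳ-≤ (d * d) (ℕP.*-monoˡ-≤ (K * K) (ℕP.m≤m*n (2 * k) (2 * k))) ⟩
  d * d * (2 * k * (2 * k) * (K * K))      ≡⟨ solve 3 (λ d k p → d :* d :* (con 2 :* k :* (con 2 :* k) :* p) := con 2 :* d :* k :* (con 2 :* d :* k) :* p) refl d k (K * K) ⟩
  2 * d * k * (2 * d * k) * (K * K)        ∎
  where open ℕP.≤-Reasoning

not-universal : ∀ d c → (∀ w → 1 ≤ w → SparseExpander d w (4 * w)) → let k = 2 + c in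
                ∀ n (v : Fin n → ℕ) (G : ∀ i → Graph (v i)) → (∀ i → v i ≤ k) →
                ¬ MinorUniversalFor (prodGraph n v G) (λ e → e * e * n ≤ 2 * d * k * (2 * d * k) * k ^ (2 * n))
not-universal d c sparse n v G v≤k universal = refute (root q (2 * k * (k ^ n * k ^ n)) (ℕP.≤-trans (s≤s z≤n) (ℕP.m≤n+m (k * 1) n)))
  where
  k q : ℕ
  k = 2 + c
  -- The factor n + k (t + 1) of `layer-bound` at t = 0.
  q = n + k * 1
  square : k ^ n * k ^ n ≡ k ^ (2 * n)
  square = trans (PE.sym (ℕP.^-distribˡ-+-* k n n)) (cong (λ m → k ^ (n + m)) (PE.sym (ℕP.+-identityʳ n)))
  refute : ¬ ∃ λ w → w * w * q ≤ 2 * k * (k ^ n * k ^ n) × (∀ b → b * b * q ≤ 2 * k * (k ^ n * k ^ n) → b ≤ w)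
  refute (w , below , largest) = conclude (sparse w 1≤w)
    where
    layer≤w : ∀ t → layer c n 0 t ≤ w
    layer≤w t = largest (layer c n 0 t)
      (subst (λ p → layer c n 0 t * layer c n 0 t * q ≤ 2 * k * (p * p)) (ℕP.*-identityʳ (k ^ n)) (layer-bound c n 0 t))
    1≤w : 1 ≤ w
    -- The coefficient at weight zero is 1, so the maximal w is positive and the expander exists.
    1≤w = subst (_≤ w) (layer-zero c n 0) (layer≤w 0)
    conclude : ¬ SparseExpander d w (4 * w)
    conclude (H , noIso , few , expand) =
      no-thin-expander {w = w} {H} refl 1≤w expand (layered-≼ (prodGraph-layered n v G v≤k layer≤w) (universal H noIso
        (subst (λ K → edgeCount H * edgeCount H * n ≤ 2 * d * k * (2 * d * k) * K) square
          (scale-bound d (edgeCount H) k n q w (k ^ n) few (ℕP.m≤m+n n (k * 1)) below))))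

upper-bound : ∀ d → (∀ w → 1 ≤ w → SparseExpander d w (4 * w)) → (k : ℕ) → 2 ≤ k → Σ ℕ λ C →
    (n : ℕ) (v : Fin n → ℕ) (G : (i : Fin n) → Graph (v i)) → (∀ i → v i ≤ k) →
    ¬ MinorUniversalFor (prodGraph n v G)
    (λ e → e * e * n ≤ C * C * k ^ (2 * n))
upper-bound d sparse (suc (suc c)) (s≤s (s≤s _)) = 2 * d * (2 + c) , not-universal d c sparse

theoremB : ((k n : ℕ) → 1 ≤ n → (v : Fin n → ℕ) → (G : (i : Fin n) → Graph (v i)) →
    (∀ i → v i ≤ k) → (∀ i → Connected (G i)) →
    (H₄ : Graph 4) → Connected H₄ → (Hₖ : Graph k) → Connected Hₖ →
    MinorUniversalFor (H₄ □ (Cycle (6 * n ∸ 2) □ (Hₖ □ prodGraph n v G)))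
    (λ e → 16 * e ≤ prodSize n v))
    ×
    ((k : ℕ) → 2 ≤ k → Σ ℕ λ C →
    (n : ℕ) (v : Fin n → ℕ) (G : (i : Fin n) → Graph (v i)) → (∀ i → v i ≤ k) →
    ¬ MinorUniversalFor (prodGraph n v G)
    (λ e → e * e * n ≤ C * C * k ^ (2 * n)))
theoremB = lower-bound , upper-bound 152 (λ w → sparse-expander w (4 * w) refl)
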